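{- Let $\mu=(\mu_1,\dots,\mu_{\ell(\mu)})$ be a partition. Then $$b_\mu^{\,|\mu|-\ell(\mu)+1} = \mathfrak{A}_{(\mu_1-1,\ \mu_2-1,\ \dots,\ \mu_{\ell(\mu)}-1)} .$$
   Context: A partition $\mu$ of $n$ (written $\mu\vdash n$) is a non-increasing finite sequence of positive integers (parts) with sum $n=|\mu|$; $\ell(\mu)$ is its number of parts. Definition of $b^k_\mu$. View $S_{2n}$ as the group of permutations of $\{1,\bar 1,\dots,n,\bar n\}$, with the convention $\overline{\bar i}=i$. The hyperoctahedral group $H_n\subset S_{2n}$ consists of the $\sigma$ with $\overline{\sigma(i)}=\sigma(\bar i)$ for all $i$. Put $p_n=\sum_{h\in H_n}h$. For $\sigma\in S_{2n}$, let $G_\sigma$ be the (multi)graph on vertex set $\{1,\bar1,\dots,n,\bar n\}$ with a solid edge between $i$ and $\bar i$ and a dashed edge between $\sigma(i)$ and $\sigma(\bar i)$ for each $i=1,\dots,n$. It is a disjoint union of cycles of even lengths $2\mu_1\ge 2\mu_2\ge\cdots$ (a solid and a dashed edge with the same endpoints form a cycle of length 2); the partition $\mu=(\mu_1,\mu_2,\dots)\vdash n$ is the coset-type of $\sigma$. Let $\mathcal{C}^{(2)}_\mu$ be the sum of all $\sigma\in S_{2n}$ of coset-type $\mu$. With the order $1<\bar1<2<\bar2<\cdots<n<\bar n$, put $$J^{(2)}_i=\sum_{j=1,\bar1,\dots,i-1,\overline{i-1}}(j\ i),\qquad 1\le i\le n .$$ These elements commute, and for every symmetric function $F$ the element $F(J^{(2)}_1,\dots,J^{(2)}_n)\,p_n$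 is a linear combination of the $\mathcal{C}^{(2)}_\mu$, $\mu\vdash n$. With $h_k$ the complete homogeneous symmetric function of degree $k$ ($h_0=1$), the coefficients $b^k_\mu$ are defined by $$h_k(J^{(2)}_1,\dots,J^{(2)}_n)\,p_n=\sum_{\mu\vdash n}b^k_\mu\,\mathcal{C}^{(2)}_\mu .$$ Definition of $\mathfrak{A}_I$. A Dyck path of length $2k$ is a lattice path with $2k$ steps $(1,1)$ and $(1,-1)$, from $(0,0)$ to $(2k,0)$, never going below the $x$-axis. The area under a Dyck path is the Euclidean area of the region between the path and the $x$-axis. A weak composition is a finite sequence of non-negative integers. For a weak composition $I=(i_1,\dots,i_r)$, let $\mathcal{P}_I$ be the set of Dyck paths of length $2(i_1+\dots+i_r)$ whose height after $2i_1$, $2(i_1+i_2)$, $\dots$ steps is zero (that is, concatenations of Dyck paths of lengths $2i_1,2i_2,\dots,2i_r$). Then $\mathfrak{A}_I$ is the sum, over all paths in $\mathcal{P}_I$, of the area under the path. -}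

module Defs where

open import Data.Fin.Base as Fin using (Fin; combine; remQuot; opposite)
open import Data.Fin.Patterns using (0F; 1F)
import Data.Fin.Properties as Finₚ
open import Data.Fin.Permutation
  using (Permutation′; id; insert; transpose; _∘ₚ_; _⟨$⟩ʳ_; _≈_)
open import Data.Integer.Base as ℤ using (ℤ; 0ℤ; 1ℤ)
open import Data.List.Base
  using (List; []; _∷_; _++_; map; concatMap; cartesianProductWith; filter;
         foldr; length; mapMaybe; reverse; tabulate; allFin)
open import Data.List.Membership.Propositional using (_∈_)
open import Data.List.Membership.Propositional.Properties
  using (∈-∃++; ∈-allFin)
open import Data.List.Membership.DecPropositional using () renaming (_∈?_ to mem?)
open import Data.List.Relation.Binary.Permutation.Propositional
  using (_↭_; ↭-refl; ↭-sym; ↭-trans; prep)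
open import Data.List.Relation.Binary.Permutation.Propositional.Properties
  using (¬x∷xs↭[]; ∈-resp-↭; shift; drop-∷)
open import Data.List.Relation.Unary.All using (All; all?)
open import Data.List.Relation.Unary.Any using (here; there)
open import Data.List.Relation.Unary.Linked using (Linked; linked?)
open import Data.Maybe.Base as Maybe using (Maybe)
open import Data.Nat.Base using (ℕ; zero; suc; _+_; _*_; _∸_; _/_; _≥_; _>_)
open import Data.Nat.ListAction using (sum)
import Data.Nat.Properties as ℕₚ
open import Data.Product.Base using (_×_; _,_; ∃)
open import Data.Sum.Base using (_⊎_; inj₁; inj₂)
open import Relation.Binary.Construct.Closure.Equivalence using (EqClosure)
open import Relation.Binary.Construct.Closure.ReflexiveTransitive
  using (ε; _◅_; _◅◅_)
open import Relation.Binary.Construct.Closure.Symmetric using (SymClosure; fwd; bwd)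
open import Relation.Binary.PropositionalEquality.Core using (_≡_; refl)
open import Relation.Nullary.Decidable
  using (Dec; yes; no; dec⇒maybe; map′; _×-dec_; _⊎-dec_; _→-dec_)

------------------------------------------------------------------------
-- Partitions

record Partition (n : ℕ) : Set where
  constructor mkPartition
  field
    parts          : List ℕ
    .nonIncreasing : Linked _≥_ parts
    .positive      : All (_> 0) parts
    .sum-parts     : sum parts ≡ n

open Partition public

ℓ : ∀ {n} → Partition n → ℕ
ℓ μ = length (parts μ)

-- All lists of positive integers with sum n, each listed once.
compositions : ℕ → List (List ℕ)
compositions zero    = [] ∷ []
compositions (suc n) = concatMap extend (compositions n)
  where
  extend : List ℕ → List (List ℕ)
  extend []       = (1 ∷ []) ∷ []
  extend (p ∷ ps) = (1 ∷ p ∷ ps) ∷ (suc p ∷ ps) ∷ []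

asPartition : ∀ n → List ℕ → Maybe (Partition n)
asPartition n ps = Maybe.map (λ (d , p , s) → mkPartition ps d p s)
  (dec⇒maybe (linked? ℕₚ._≥?_ ps ×-dec all? (ℕₚ._>? 0) ps ×-dec (sum ps ℕₚ.≟ n)))

partitions : ∀ n → List (Partition n)
partitions n = mapMaybe (asPartition n) (compositions n)

------------------------------------------------------------------------
-- The group ring ℤ[S_m]

-- Elements are formal ℤ-linear combinations of permutations of Fin m, possibly
-- with repetitions; two of them are the same element of the group ring when
-- they have the same coefficients, see _≋_.
ℤ[S_] : ℕ → Set
ℤ[S m ] = List (ℤ × Permutation′ m)

module _ {m : ℕ} where

  _≈?_ : (σ τ : Permutation′ m) → Dec (σ ≈ τ)
  σ ≈? τ = Finₚ.all? λ i → (σ ⟨$⟩ʳ i) Finₚ.≟ (τ ⟨$⟩ʳ i)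

  coefficient : Permutation′ m → ℤ[S m ] → ℤ
  coefficient σ []             = 0ℤ
  coefficient σ ((a , τ) ∷ x) with σ ≈? τ
  ... | yes _ = a ℤ.+ coefficient σ x
  ... | no  _ = coefficient σ x

  infix  4 _≋_
  infixl 7 _·_
  infixr 8 _•_

  _≋_ : ℤ[S m ] → ℤ[S m ] → Set
  x ≋ y = ∀ σ → coefficient σ x ≡ coefficient σ y

  one : ℤ[S m ]
  one = (1ℤ , id) ∷ []

  -- The product στ is "first τ, then σ"; _∘ₚ_ composes in the other order.
  _·_ : ℤ[S m ] → ℤ[S m ] → ℤ[S m ]
  _·_ = cartesianProductWith λ (a , σ) (b , τ) → (a ℤ.* b , τ ∘ₚ σ)

  _•_ : ℤ → ℤ[S m ] → ℤ[S m ]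
  a • x = map (λ (b , σ) → (a ℤ.* b , σ)) x

  Σ-of : List (Permutation′ m) → ℤ[S m ]
  Σ-of = map (1ℤ ,_)

  Σ-over : {A : Set} → List A → (A → ℤ[S m ]) → ℤ[S m ]
  Σ-over xs f = concatMap f xs

  product : List ℤ[S m ] → ℤ[S m ]
  product = foldr _·_ one

-- Every permutation of Fin m, exactly once up to _≈_; the image of 0 is chosen
-- first.
permutations : ∀ m → List (Permutation′ m)
permutations zero    = id ∷ []
permutations (suc m) =
  cartesianProductWith (insert Fin.zero) (allFin (suc m)) (permutations m)

------------------------------------------------------------------------
-- Complete homogeneous symmetric functions

-- All multisets of k entries of xs, written in the order of xs.
multisets : {A : Set} → ℕ → List A → List (List A)
multisets zero    xs       = [] ∷ []
multisets (suc k) []       = []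
multisets (suc k) (x ∷ xs) = map (x ∷_) (multisets k (x ∷ xs)) ++ multisets (suc k) xs

-- h_k evaluated at pairwise commuting elements: the sum of all monomials of
-- degree k.
h : ∀ {m} → ℕ → List ℤ[S m ] → ℤ[S m ]
h k xs = Σ-over (multisets k xs) product

------------------------------------------------------------------------
-- The points 1, 1̄, …, n, n̄

-- The order of Fin (n * 2) is 1 < 1̄ < 2 < 2̄ < ⋯ < n < n̄.
Point : ℕ → Set
Point n = Fin (n * 2)

plain barred : ∀ n → Fin n → Point n
plain  n i = combine i 0F
barred n i = combine i 1F

bar : ∀ n → Point n → Point n
bar n v with remQuot {n} 2 v
... | (i , e) = combine i (opposite e)

module _ (n : ℕ) where

  Hyperoctahedral : Permutation′ (n * 2) → Set
  Hyperoctahedral σ = ∀ v → bar n (σ ⟨$⟩ʳ v) ≡ σ ⟨$⟩ʳ bar n v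

  hyperoctahedral? : ∀ σ → Dec (Hyperoctahedral σ)
  hyperoctahedral? σ = Finₚ.all? λ v → bar n (σ ⟨$⟩ʳ v) Finₚ.≟ (σ ⟨$⟩ʳ bar n v)

  p : ℤ[S n * 2 ]
  p = Σ-of (filter hyperoctahedral? (permutations (n * 2)))

  J : Fin n → ℤ[S n * 2 ]
  J i = Σ-of (map (λ j → transpose j (plain n i))
                  (filter (Finₚ._<? plain n i) (allFin (n * 2))))

------------------------------------------------------------------------
-- Coset-types

  SolidEdge : Point n → Point n → Set
  SolidEdge v w = ∃ λ i → v ≡ plain n i × w ≡ barred n i

  DashedEdge : Permutation′ (n * 2) → Point n → Point n → Set
  DashedEdge σ v w = ∃ λ i → v ≡ σ ⟨$⟩ʳ plain n i × w ≡ σ ⟨$⟩ʳ barred n i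

  Edge : Permutation′ (n * 2) → Point n → Point n → Set
  Edge σ v w = SolidEdge v w ⊎ DashedEdge σ v w

  Connected : Permutation′ (n * 2) → Point n → Point n → Set
  Connected σ = EqClosure (Edge σ)

-- Floyd–Warshall: R-via us v w says that some walk from v to w has all its
-- intermediate vertices in us.
module _ {m : ℕ} {E : Fin m → Fin m → Set} (E? : ∀ v w → Dec (E v w)) where
  private
    R-via : List (Fin m) → Fin m → Fin m → Set
    R-via []       v w = v ≡ w ⊎ E v w ⊎ E w v
    R-via (u ∷ us) v w = R-via us v w ⊎ R-via us v u × R-via us u w

    R-via? : ∀ us v w → Dec (R-via us v w)
    R-via? []       v w = (v Finₚ.≟ w) ⊎-dec (E? v w ⊎-dec E? w v)
    R-via? (u ∷ us) v w = R-via? us v w ⊎-dec (R-via? us v u ×-dec R-via? us u w)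

    sound : ∀ us {v w} → R-via us v w → EqClosure E v w
    sound []       (inj₁ refl)     = ε
    sound []       (inj₂ (inj₁ e)) = fwd e ◅ ε
    sound []       (inj₂ (inj₂ e)) = bwd e ◅ ε
    sound (u ∷ us) (inj₁ r)        = sound us r
    sound (u ∷ us) (inj₂ (r , s))  = sound us r ◅◅ sound us s

    weaken : ∀ us {v w} → R-via [] v w → R-via us v w
    weaken []       r = r
    weaken (u ∷ us) r = inj₁ (weaken us r)

    to-head : ∀ {u us v} → R-via (u ∷ us) v u → R-via us v u
    to-head (inj₁ r)       = r
    to-head (inj₂ (r , _)) = r

    from-head : ∀ {u us w} → R-via (u ∷ us) u w → R-via us u w
    from-head (inj₁ r)       = r
    from-head (inj₂ (_ , r)) = r

    compose : ∀ us {u v w} → u ∈ us → R-via us v u → R-via us u w → R-via us v w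
    compose (u ∷ us) (here refl) r s = inj₂ (to-head {us = us} r , from-head {us = us} s)
    compose (u ∷ us) (there i) (inj₁ r)       (inj₁ s)       = inj₁ (compose us i r s)
    compose (u ∷ us) (there i) (inj₁ r)       (inj₂ (s , t)) = inj₂ (compose us i r s , t)
    compose (u ∷ us) (there i) (inj₂ (q , r)) (inj₁ s)       = inj₂ (q , compose us i r s)
    compose (u ∷ us) (there i) (inj₂ (q , r)) (inj₂ (s , t)) = inj₂ (q , t)

    step : ∀ {v w} → SymClosure E v w → R-via [] v w
    step (fwd e) = inj₂ (inj₁ e)
    step (bwd e) = inj₂ (inj₂ e)

    complete : ∀ {v w} → EqClosure E v w → R-via (allFin m) v w
    complete ε       = weaken (allFin m) (inj₁ refl)
    complete (e ◅ c) =
      compose (allFin m) (∈-allFin _) (weaken (allFin m) (step e)) (complete c)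

  eqClosure? : ∀ v w → Dec (EqClosure E v w)
  eqClosure? v w = map′ (sound (allFin m)) complete (R-via? (allFin m) v w)

_↭?_ : (xs ys : List ℕ) → Dec (xs ↭ ys)
[]       ↭? []       = yes ↭-refl
[]       ↭? (y ∷ ys) = no λ q → ¬x∷xs↭[] (↭-sym q)
(x ∷ xs) ↭? ys with mem? ℕₚ._≟_ x ys
... | no x∉ys  = no λ q → x∉ys (∈-resp-↭ q (here refl))
... | yes x∈ys with ∈-∃++ x∈ys
...   | (as , bs , refl) =
  map′ (λ q → ↭-trans (prep x q) (↭-sym (shift x as bs)))
       (λ q → drop-∷ (↭-trans q (shift x as bs)))
       (xs ↭? (as ++ bs))

module _ (n : ℕ) where

  edge? : ∀ σ v w → Dec (Edge n σ v w)
  edge? σ v w =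
    Finₚ.any? (λ i → (v Finₚ.≟ plain n i) ×-dec (w Finₚ.≟ barred n i))
    ⊎-dec
    Finₚ.any? (λ i → (v Finₚ.≟ (σ ⟨$⟩ʳ plain n i)) ×-dec (w Finₚ.≟ (σ ⟨$⟩ʳ barred n i)))

  connected? : ∀ σ v w → Dec (Connected n σ v w)
  connected? σ = eqClosure? (edge? σ)

  component : Permutation′ (n * 2) → Point n → List (Point n)
  component σ v = filter (connected? σ v) (allFin (n * 2))

  -- The least vertex of each connected component.
  representatives : Permutation′ (n * 2) → List (Point n)
  representatives σ =
    filter (λ v → Finₚ.all? λ w → connected? σ v w →-dec (v Finₚ.≤? w)) (allFin (n * 2))

  -- The components are cycles, so their lengths are their numbers of vertices.
  cycleLengths : Permutation′ (n * 2) → List ℕ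
  cycleLengths σ = map (λ v → length (component σ v)) (representatives σ)

  HasCosetType : Partition n → Permutation′ (n * 2) → Set
  HasCosetType μ σ = cycleLengths σ ↭ map (2 *_) (parts μ)

  hasCosetType? : ∀ μ σ → Dec (HasCosetType μ σ)
  hasCosetType? μ σ = cycleLengths σ ↭? map (2 *_) (parts μ)

  𝒞 : Partition n → ℤ[S n * 2 ]
  𝒞 μ = Σ-of (filter (hasCosetType? μ) (permutations (n * 2)))

  -- The J i commute, so the variables may be listed in any order; monomials are
  -- written here with decreasing indices.
  hJ : ℕ → ℤ[S n * 2 ]
  hJ k = h k (reverse (tabulate (J n)))

  -- The equation defining the numbers b^k_μ, μ ⊢ n.  It determines b, because
  -- the 𝒞 μ are non-empty sums over disjoint sets of permutations.
  IsCoefficientFamily : ℕ → (Partition n → ℤ) → Set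
  IsCoefficientFamily k b = hJ k · p n ≋ Σ-over (partitions n) (λ μ → b μ • 𝒞 μ)

------------------------------------------------------------------------
-- Dyck paths

-- Path a l b: lattice paths with l steps (1,1) or (1,-1) from height a to
-- height b; heights are natural numbers, so they never go below the x-axis.
data Path : ℕ → ℕ → ℕ → Set where
  stop : ∀ {a} → Path a 0 a
  up   : ∀ {a l b} → Path (suc a) l b → Path a (suc l) b
  down : ∀ {a l b} → Path a l b → Path (suc a) (suc l) b

DyckPath : ℕ → Set
DyckPath k = Path 0 (2 * k) 0

paths : ∀ a l b → List (Path a l b)
paths a zero b with a ℕₚ.≟ b
... | yes refl = stop ∷ []
... | no  _    = []
paths zero    (suc l) b = map up (paths 1 l b)
paths (suc a) (suc l) b = map up (paths (suc (suc a)) l b) ++ map down (paths a l b)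

dyckPaths : ∀ k → List (DyckPath k)
dyckPaths k = paths 0 (2 * k) 0

-- Past the end of the path, this is the final height.
heightAfter : ∀ {a l b} → ℕ → Path a l b → ℕ
heightAfter {a} zero    _        = a
heightAfter {a} (suc t) stop     = a
heightAfter     (suc t) (up π)   = heightAfter t π
heightAfter     (suc t) (down π) = heightAfter t π

-- Twice the area: under a step from height a to height b lies a trapezoid of
-- area (a + b) / 2.
doubleArea : ∀ {a l b} → Path a l b → ℕ
doubleArea     stop             = 0
doubleArea {a} (up π)           = (a + suc a) + doubleArea π
doubleArea     (down {a = a} π) = (suc a + a) + doubleArea π

-- The division is exact: the double area of a Dyck path is even.
area : ∀ {k} → DyckPath k → ℕ
area π = doubleArea π / 2

WeakComposition : Set
WeakComposition = List ℕ

-- t + 2 i₁, t + 2 (i₁ + i₂), …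
returnTimes : ℕ → WeakComposition → List ℕ
returnTimes t []      = []
returnTimes t (i ∷ I) = (t + 2 * i) ∷ returnTimes (t + 2 * i) I

𝒫 : (I : WeakComposition) → List (DyckPath (sum I))
𝒫 I = filter (λ π → all? (λ t → heightAfter t π ℕₚ.≟ 0) (returnTimes 0 I))
             (dyckPaths (sum I))

𝔄 : WeakComposition → ℕ
𝔄 I = sum (map (area {sum I}) (𝒫 I))

{-# OPTIONS --safe #-}

-- The coefficient of σ in h_k(J₁, …, J_n) p_n counts the ways of turning the
-- matching of dashed edges of σ into the solid one with k transpositions of the
-- J's, with weakly decreasing indices.  Let q + 1 be the size of the cycle
-- through n in a σ of coset type μ, and I the list of the other μᵢ - 1.  Among the
-- transpositions (s n), for each a + b = q - 1 one splits that cycle into cycles of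
-- sizes a + 1 and b + 1, q of them preserve the coset type, and the others merge
-- two cycles.  Each step raises the number of cycles by at most one, so b^k_μ
-- vanishes for k < |μ| - ℓ(μ), and for k = |μ| - ℓ(μ) and k = |μ| - ℓ(μ) + 1
-- the merging terms vanish:
--   B(q, I) = Σ_{a+b=q-1} B(a, b, I) + q B′(q, I),   B(0, I) = B(I),
-- where B′ is the coefficient of degree one less.  The products of Catalan numbers
-- and the areas 𝔄 satisfy the same recursions, by first-passage decomposition.
module Submission where

open import Defs
open import Data.Bool.Base using (true; false; if_then_else_)
open import Data.Fin.Base as Fin using (Fin; toℕ; fromℕ<; remQuot; combine; opposite)
open import Data.Fin.Patterns using (0F; 1F)
open import Data.Fin.Permutation
  using (Permutation′; transpose; flip; inverseˡ; inverseʳ; _∘ₚ_; _⟨$⟩ʳ_; _⟨$⟩ˡ_; _≈_;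
         insert; remove; insert-punchIn; punchIn-permute)
  renaming (id to idₚ)
import Data.Fin.Properties as Finₚ
open import Data.List.Base
  using (List; []; _∷_; map; filter; length; _++_; allFin; concatMap; cartesianProductWith;
         tabulate; reverse; take; mapMaybe)
import Data.List.Membership.Propositional as Mem
open import Data.List.Membership.Propositional using (_∈_; _∉_; lose)
open import Data.List.Membership.Propositional.Properties
  using (∈-allFin; ∈-filter⁺; ∈-filter⁻; ∈-∃++; ∈-map⁻; ∈-map⁺; ∈-++⁻; ∈-++⁺ˡ; ∈-++⁺ʳ;
         ∈-concatMap⁺; ∈-concatMap⁻)
open import Data.List.Membership.Propositional.Properties.WithK using (unique∧set⇒bag)
open import Data.List.Properties
  using (map-++; filter-++; length-++; length-map; ++-assoc; concatMap-++; map-cong; reverse-++;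
         take-suc-tabulate; take-all; length-tabulate; filter-≐; map-injective)
open import Data.List.Relation.Binary.BagAndSetEquality using (∼bag⇒↭)
import Data.List.Relation.Binary.Permutation.Propositional as ↭
open import Data.List.Relation.Binary.Permutation.Propositional
  using (_↭_; ↭-refl; ↭-sym; ↭-trans; ↭-reflexive; prep; swap; ↭⇒↭ₛ)
open import Data.List.Relation.Binary.Permutation.Propositional.Properties
  using (∈-resp-↭; All-resp-↭; shift; shifts; drop-∷; ++⁺ˡ; ++⁺ʳ; ++-comm; ↭-length; ↭-map-inv)
  renaming (map⁺ to map-↭)
import Data.List.Relation.Binary.Permutation.Setoid.Properties as ↭ₛ
open import Data.List.Relation.Binary.Pointwise using (Pointwise-≡⇒≡)
open import Data.List.Relation.Unary.All as All using (All; []; _∷_; all?)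
import Data.List.Relation.Unary.All.Properties as Allₚ
open import Data.List.Relation.Unary.AllPairs using ([]; _∷_)
open import Data.List.Relation.Unary.Any using (here; there)
open import Data.List.Relation.Unary.Linked using (Linked; linked?)
open import Data.List.Relation.Unary.Sorted.TotalOrder.Properties using (↗↭↗⇒≋)
open import Data.List.Relation.Unary.Unique.Propositional using (Unique)
import Data.List.Relation.Unary.Unique.Propositional.Properties as Uniqueₚ
open import Data.List.Relation.Unary.Unique.Propositional.Properties
  using (allFin⁺; filter⁺; Unique[x∷xs]⇒x∉xs)
open import Data.Maybe.Base using (just; nothing)
open import Data.Nat.Base
open import Data.Nat.Divisibility
  using (_∣_; divides; ∣m∣n⇒∣m+n; ∣m+n∣m⇒∣n; m∣m*n)
open import Data.Nat.DivMod using (m*[n/m]≡n)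
open import Data.Nat.ListAction using (sum)
open import Data.Nat.ListAction.Properties using (sum-++; sum-↭)
open import Data.Nat.Properties
open import Data.Nat.Tactic.RingSolver using (solve-∀)
open import Data.Product.Base using (_×_; _,_; ∃; ∃₂; proj₁; proj₂)
open import Data.Sum.Base using (_⊎_; inj₁; inj₂)
open import Function.Base using (_∘_; case_of_)
open import Function.Bundles using (mk⇔)
open import Level using (0ℓ)
import Relation.Binary.Construct.Closure.Equivalence as EqClosure
open import Relation.Binary.Construct.Closure.ReflexiveTransitive using (ε; _◅_; _◅◅_)
open import Relation.Binary.Construct.Closure.Symmetric using (SymClosure; fwd; bwd)
import Relation.Binary.Construct.Flip.EqAndOrd as Flip
open import Relation.Binary.PropositionalEquality
  using (_≡_; _≢_; refl; sym; cong; cong₂; subst; setoid; module ≡-Reasoning)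
  renaming (trans to ≡-trans)
open import Relation.Nullary using (¬_; Dec; yes; no; contradiction; does)
open import Relation.Nullary.Decidable
  using (dec-true; dec-false; recompute; _→-dec_; _×-dec_)
open import Relation.Unary using (Pred; Decidable)

-- Catalan numbers and areas

-- The count is carried out for every permutation with given cycle sizes, so that its dependence on
-- the coset type alone comes out of the induction; one `σ` for each `μ` then determines `b μ`.
-- Indices decrease weakly: once the largest variable is given up, nothing moves its two points any
-- more. The terms without it vanish unless these points are already joined by a dashed edge, and
-- then they pose the same problem on fewer points. This is the source of B(0, I) = B(I). Each of
-- the q other solid edges of the cycle has two ends: the transposition with one end splits the
-- cycle, the one with the other end reverses a stretch of it. The governing number is c = k + 1 -
-- ΣI. Splitting keeps it, reversing lowers it by 1, merging by 2; so c ≤ 2 persists, and merging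
-- leads to c = 0. On the side of paths, enclosing a Dyck path with x up-steps between an up-step
-- and a down-step adds 2x + 1 to its area. Averaged with the mirrored term, where x + y = q - 1,
-- this is q, the number of transpositions that preserve the coset type. All values are doubled to
-- keep the areas of single steps integral.

splits : (ℕ → ℕ → ℕ) → ℕ → ℕ
splits H zero    = 0
splits H (suc q) = H 0 q + splits (λ a b → H (suc a) b) q

splits-cong : ∀ {H K} q → (∀ a b → suc (a + b) ≡ q → H a b ≡ K a b) → splits H q ≡ splits K q
splits-cong zero    e = refl
splits-cong (suc q) e =
  cong₂ _+_ (e 0 q refl) (splits-cong q λ a b eq → e (suc a) b (cong suc eq))

splits-+ : ∀ H K q → splits (λ a b → H a b + K a b) q ≡ splits H q + splits K q
splits-+ H K zero    = refl
splits-+ H K (suc q) =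
  ≡-trans (cong (H 0 q + K 0 q +_) (splits-+ (λ a → H (suc a)) (λ a → K (suc a)) q))
          (lemma (H 0 q) (K 0 q) _ _)
  where
  lemma : ∀ a b c d → a + b + (c + d) ≡ (a + c) + (b + d)
  lemma = solve-∀

splits-* : ∀ c H q → splits (λ a b → c * H a b) q ≡ c * splits H q
splits-* c H zero    = sym (*-zeroʳ c)
splits-* c H (suc q) =
  ≡-trans (cong (c * H 0 q +_) (splits-* c (λ a → H (suc a)) q)) (sym (*-distribˡ-+ c (H 0 q) _))

splits-+* : ∀ H c K q → splits (λ a b → H a b + c * K a b) q ≡ splits H q + c * splits K q
splits-+* H c K q =
  ≡-trans (splits-+ H (λ a b → c * K a b) q) (cong (splits H q +_) (splits-* c K q))

splits-last : ∀ H q → splits H (suc q) ≡ splits (λ a b → H a (suc b)) q + H q 0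
splits-last H zero    = +-identityʳ (H 0 0)
splits-last H (suc q) =
  ≡-trans (cong (H 0 (suc q) +_) (splits-last (λ a → H (suc a)) q)) (sym (+-assoc (H 0 (suc q)) _ _))

splits-flip : ∀ H q → splits (λ a b → H b a) q ≡ splits H q
splits-flip H zero    = refl
splits-flip H (suc q) = ≡-trans (cong (H q 0 +_) (splits-flip (λ a b → H a (suc b)) q))
  (≡-trans (+-comm (H q 0) _) (sym (splits-last H q)))

-- N a u counts the lattice paths from height a to height 0 with u up-steps,
-- and A a u adds up their double areas.
N : ℕ → ℕ → ℕ
N zero    zero    = 1
N zero    (suc u) = N 1 u
N (suc a) zero    = N a zero
N (suc a) (suc u) = N (2 + a) u + N a (suc u)

A : ℕ → ℕ → ℕ
A zero    zero    = 0
A zero    (suc u) = A 1 u + N 1 u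
A (suc a) zero    = A a zero + (2 * a + 1) * N a zero
A (suc a) (suc u) =
  (A (2 + a) u + (2 * a + 3) * N (2 + a) u) + (A a (suc u) + (2 * a + 1) * N a (suc u))

-- A path from height suc a is cut by the step with which it first reaches
-- height 0: before it comes a path from a to 0 raised by 1, after it a Dyck path.
N-firstPassage : ∀ a u → N (suc a) u ≡ splits (λ x y → N a x * N 0 y) (suc u)
N-firstPassage zero    zero    = refl
N-firstPassage (suc a) zero    = sym (≡-trans (+-identityʳ _) (*-identityʳ _))
N-firstPassage zero    (suc u) =
  ≡-trans (+-comm (N 2 u) _) (cong₂ _+_ (sym (+-identityʳ (N 1 u))) (N-firstPassage 1 u))
N-firstPassage (suc a) (suc u) = begin
  N (3 + a) u + N (suc a) (suc u)
    ≡⟨ cong₂ _+_ (N-firstPassage (2 + a) u) (N-firstPassage a (suc u)) ⟩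
  splits (λ x y → N (2 + a) x * N 0 y) (suc u) +
  (N a 0 * N 0 (suc u) + splits (λ x y → N a (suc x) * N 0 y) (suc u))
    ≡⟨ lemma (splits (λ x y → N (2 + a) x * N 0 y) (suc u)) (N a 0 * N 0 (suc u)) _ ⟩
  N a 0 * N 0 (suc u) + (splits (λ x y → N (2 + a) x * N 0 y) (suc u) +
                         splits (λ x y → N a (suc x) * N 0 y) (suc u))
    ≡⟨ cong (N a 0 * N 0 (suc u) +_)
         (sym (splits-+ (λ x y → N (2 + a) x * N 0 y) (λ x y → N a (suc x) * N 0 y) (suc u))) ⟩
  N a 0 * N 0 (suc u) + splits (λ x y → N (2 + a) x * N 0 y + N a (suc x) * N 0 y) (suc u)
    ≡⟨ cong (N a 0 * N 0 (suc u) +_)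
         (splits-cong (suc u) λ x y _ → sym (*-distribʳ-+ (N 0 y) (N (2 + a) x) (N a (suc x)))) ⟩
  N a 0 * N 0 (suc u) + splits (λ x y → (N (2 + a) x + N a (suc x)) * N 0 y) (suc u) ∎
  where
  open ≡-Reasoning
  lemma : ∀ x y z → x + (y + z) ≡ y + (x + z)
  lemma = solve-∀

-- The double area of the paths cut at their first passage. A path from `a` to 0 with `x` up-steps
-- has `a + 2 * x` steps; raising it by 1 adds 2 for each of them, and the step from height 1 to
-- height 0 adds 1.
raised : ℕ → ℕ → ℕ → ℕ
raised a x y = (A a x + (2 * (a + 2 * x) + 1) * N a x) * N 0 y + N a x * A 0 y

-- Induction on the first step, which belongs to the raised part: going up lengthens that part by an
-- up-step, going down lowers its starting height, and at `a = 0` the down-step ends it, which gives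
-- the term with `x = 0`.
A-firstPassage : ∀ a u → A (suc a) u ≡ splits (raised a) (suc u)
A-firstPassage zero    zero    = refl
A-firstPassage (suc a) zero    = lemma a (A a 0) (N a 0)
  where
  lemma : ∀ a d m → (d + (2 * a + 1) * m) + (2 * suc a + 1) * m ≡
    (d + (2 * a + 1) * m + (2 * (suc a + 0) + 1) * m) * 1 + m * 0 + 0
  lemma = solve-∀
A-firstPassage zero    (suc u) = begin
  (A 2 u + 3 * N 2 u) + (A 0 (suc u) + 1 * N 0 (suc u))
    ≡⟨ cong (_+ (A 0 (suc u) + 1 * N 0 (suc u)))
         (cong₂ _+_ (A-firstPassage 1 u)
           (≡-trans (cong (3 *_) (N-firstPassage 1 u)) (sym (splits-* 3 (λ x y → N 1 x * N 0 y) (suc u))))) ⟩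
  (splits (raised 1) (suc u) + splits (λ x y → 3 * (N 1 x * N 0 y)) (suc u)) +
  (A 0 (suc u) + 1 * N 0 (suc u))
    ≡⟨ cong (_+ (A 0 (suc u) + 1 * N 0 (suc u))) (sym (splits-+ (raised 1) (λ x y → 3 * (N 1 x * N 0 y)) (suc u))) ⟩
  splits (λ x y → raised 1 x y + 3 * (N 1 x * N 0 y)) (suc u) + (A 0 (suc u) + 1 * N 0 (suc u))
    ≡⟨ cong (_+ (A 0 (suc u) + 1 * N 0 (suc u)))
         (splits-cong (suc u) λ x y _ → lemma₁ x (A 1 x) (N 1 x) (N 0 y) (A 0 y)) ⟩
  splits (λ x y → raised 0 (suc x) y) (suc u) + (A 0 (suc u) + 1 * N 0 (suc u))
    ≡⟨ lemma₂ (splits (λ x y → raised 0 (suc x) y) (suc u)) (A 0 (suc u)) (N 0 (suc u)) ⟩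
  raised 0 0 (suc u) + splits (λ x y → raised 0 (suc x) y) (suc u) ∎
  where
  open ≡-Reasoning
  lemma₁ : ∀ x d m c e → ((d + (2 * (1 + 2 * x) + 1) * m) * c + m * e) + 3 * (m * c) ≡
    (d + m + (2 * (0 + 2 * suc x) + 1) * m) * c + m * e
  lemma₁ = solve-∀
  lemma₂ : ∀ s d m → s + (d + 1 * m) ≡ ((0 + (2 * (0 + 2 * 0) + 1) * 1) * m + 1 * d) + s
  lemma₂ = solve-∀
A-firstPassage (suc a) (suc u) = begin
  (A (3 + a) u + (2 * suc a + 3) * N (3 + a) u) +
  (A (suc a) (suc u) + (2 * suc a + 1) * N (suc a) (suc u))
    ≡⟨ cong₂ _+_
         (cong₂ _+_ (A-firstPassage (2 + a) u) (cong ((2 * suc a + 3) *_) (N-firstPassage (2 + a) u)))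
         (cong₂ _+_ (A-firstPassage a (suc u)) (cong ((2 * suc a + 1) *_) (N-firstPassage a (suc u)))) ⟩
  (s₁ + (2 * suc a + 3) * s₂) + ((r₀ + s₃) + (2 * suc a + 1) * (m₀ + s₄))
    ≡⟨ lemma₀ s₁ s₂ s₃ s₄ r₀ m₀ (2 * suc a + 3) (2 * suc a + 1) ⟩
  (r₀ + (2 * suc a + 1) * m₀) + ((s₁ + (2 * suc a + 3) * s₂) + (s₃ + (2 * suc a + 1) * s₄))
    ≡⟨ cong (r₀ + (2 * suc a + 1) * m₀ +_) (sym collect) ⟩
  (r₀ + (2 * suc a + 1) * m₀) + splits (λ x y →
    (raised (2 + a) x y + (2 * suc a + 3) * (N (2 + a) x * N 0 y)) +
    (raised a (suc x) y + (2 * suc a + 1) * (N a (suc x) * N 0 y))) (suc u)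
    ≡⟨ cong₂ _+_ (lemma₁ a (A a 0) (N a 0) (N 0 (suc u)) (A 0 (suc u)))
         (splits-cong (suc u) λ x y _ →
           lemma₂ a x (A (2 + a) x) (N (2 + a) x) (A a (suc x)) (N a (suc x)) (N 0 y) (A 0 y)) ⟩
  raised (suc a) 0 (suc u) + splits (λ x y → raised (suc a) (suc x) y) (suc u) ∎
  where
  open ≡-Reasoning
  s₁ = splits (raised (2 + a)) (suc u)
  s₂ = splits (λ x y → N (2 + a) x * N 0 y) (suc u)
  s₃ = splits (λ x y → raised a (suc x) y) (suc u)
  s₄ = splits (λ x y → N a (suc x) * N 0 y) (suc u)
  r₀ = raised a 0 (suc u)
  m₀ = N a 0 * N 0 (suc u)
  collect : splits (λ x y →
      (raised (2 + a) x y + (2 * suc a + 3) * (N (2 + a) x * N 0 y)) +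
      (raised a (suc x) y + (2 * suc a + 1) * (N a (suc x) * N 0 y))) (suc u) ≡
    (s₁ + (2 * suc a + 3) * s₂) + (s₃ + (2 * suc a + 1) * s₄)
  collect = ≡-trans
    (splits-+ (λ x y → raised (2 + a) x y + (2 * suc a + 3) * (N (2 + a) x * N 0 y))
              (λ x y → raised a (suc x) y + (2 * suc a + 1) * (N a (suc x) * N 0 y)) (suc u))
    (cong₂ _+_
      (splits-+* (raised (2 + a)) (2 * suc a + 3) (λ x y → N (2 + a) x * N 0 y) (suc u))
      (splits-+* (λ x y → raised a (suc x) y) (2 * suc a + 1) (λ x y → N a (suc x) * N 0 y) (suc u)))
  lemma₀ : ∀ s₁ s₂ s₃ s₄ r m j k → (s₁ + j * s₂) + ((r + s₃) + k * (m + s₄)) ≡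
    (r + k * m) + ((s₁ + j * s₂) + (s₃ + k * s₄))
  lemma₀ = solve-∀
  lemma₁ : ∀ a d m c e →
    ((d + (2 * (a + 2 * 0) + 1) * m) * c + m * e) + (2 * suc a + 1) * (m * c) ≡
    ((d + (2 * a + 1) * m) + (2 * (suc a + 2 * 0) + 1) * m) * c + m * e
  lemma₁ = solve-∀
  lemma₂ : ∀ a x d m d′ m′ c e →
    (((d + (2 * (2 + a + 2 * x) + 1) * m) * c + m * e) + (2 * suc a + 3) * (m * c)) +
    (((d′ + (2 * (a + 2 * suc x) + 1) * m′) * c + m′ * e) + (2 * suc a + 1) * (m′ * c)) ≡
    (((d + (2 * a + 3) * m) + (d′ + (2 * a + 1) * m′)) +
      (2 * (suc a + 2 * suc x) + 1) * (m + m′)) * c + (m + m′) * e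
  lemma₂ = solve-∀

catalan doubleAreas : ℕ → ℕ
catalan     = N 0
doubleAreas = A 0

catalan-suc : ∀ q → catalan (suc q) ≡ splits (λ a b → catalan a * catalan b) (suc q)
catalan-suc = N-firstPassage 0

-- The raised part with `x` up-steps gains `4 * x`, and its two enclosing steps contribute 1 each.
-- One half of `4 * x` is exchanged for `2 * y` by symmetry, and `2 * x + 2 * y` is the constant
-- `2 * q`; with the enclosing steps this makes `2 * suc q`.
doubleAreas-suc : ∀ q → doubleAreas (suc q) ≡
  splits (λ a b → doubleAreas a * catalan b + catalan a * doubleAreas b) (suc q) +
  2 * suc q * catalan (suc q)
doubleAreas-suc q = begin
  A 1 q + N 1 q
    ≡⟨ cong₂ _+_ (A-firstPassage 0 q) (N-firstPassage 0 q) ⟩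
  splits (raised 0) (suc q) + splits C² (suc q)
    ≡⟨ cong (_+ splits C² (suc q))
         (splits-cong (suc q) λ x y _ → lemma₁ x (A 0 x) (N 0 x) (N 0 y) (A 0 y)) ⟩
  splits (λ x y → AC x y + ((xC² x y + xC² x y) + C² x y)) (suc q) + splits C² (suc q)
    ≡⟨ cong (_+ splits C² (suc q))
         (splits-+ AC (λ x y → (xC² x y + xC² x y) + C² x y) (suc q)) ⟩
  splits AC (suc q) + splits (λ x y → (xC² x y + xC² x y) + C² x y) (suc q) + splits C² (suc q)
    ≡⟨ cong (λ s → splits AC (suc q) + s + splits C² (suc q)) (≡-trans
         (splits-+ (λ x y → xC² x y + xC² x y) C² (suc q))
         (cong (_+ splits C² (suc q)) (≡-trans
           (splits-+ xC² xC² (suc q)) (cong (splits xC² (suc q) +_) flipped)))) ⟩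
  splits AC (suc q) + ((splits xC² (suc q) + splits yC² (suc q)) + splits C² (suc q)) +
  splits C² (suc q)
    ≡⟨ cong (λ s → splits AC (suc q) + (s + splits C² (suc q)) + splits C² (suc q)) (begin
      splits xC² (suc q) + splits yC² (suc q)
        ≡⟨ sym (splits-+ xC² yC² (suc q)) ⟩
      splits (λ x y → xC² x y + yC² x y) (suc q)
        ≡⟨ splits-cong {H = λ x y → xC² x y + yC² x y} {K = λ x y → 2 * q * C² x y} (suc q)
             (λ { x y refl → lemma₂ x y (N 0 x) (N 0 y) }) ⟩
      splits (λ x y → 2 * q * C² x y) (suc q)
        ≡⟨ splits-* (2 * q) C² (suc q) ⟩
      2 * q * splits C² (suc q) ∎) ⟩
  splits AC (suc q) + (2 * q * splits C² (suc q) + splits C² (suc q)) + splits C² (suc q)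
    ≡⟨ lemma₃ q (splits AC (suc q)) (splits C² (suc q)) ⟩
  splits AC (suc q) + 2 * suc q * splits C² (suc q)
    ≡⟨ cong (λ c → splits AC (suc q) + 2 * suc q * c) (sym (catalan-suc q)) ⟩
  splits AC (suc q) + 2 * suc q * catalan (suc q) ∎
  where
  open ≡-Reasoning
  AC C² xC² yC² : ℕ → ℕ → ℕ
  AC x y = A 0 x * N 0 y + N 0 x * A 0 y
  C² x y = N 0 x * N 0 y
  xC² x y = 2 * x * (N 0 x * N 0 y)
  yC² x y = 2 * y * (N 0 y * N 0 x)
  flipped : splits xC² (suc q) ≡ splits yC² (suc q)
  flipped = sym (splits-flip xC² (suc q))
  lemma₁ : ∀ x d m c e → (d + (2 * (0 + 2 * x) + 1) * m) * c + m * e ≡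
    (d * c + m * e) + ((2 * x * (m * c) + 2 * x * (m * c)) + m * c)
  lemma₁ = solve-∀
  lemma₂ : ∀ x y m c → 2 * x * (m * c) + 2 * y * (c * m) ≡ 2 * (x + y) * (m * c)
  lemma₂ = solve-∀
  lemma₃ : ∀ q s c → s + (2 * q * c + c) + c ≡ s + 2 * suc q * c
  lemma₃ = solve-∀

catalans doubleAreaSum : List ℕ → ℕ
catalans []      = 1
catalans (i ∷ I) = catalan i * catalans I
doubleAreaSum []      = 0
doubleAreaSum (i ∷ I) = doubleAreas i * catalans I + catalan i * doubleAreaSum I

catalans-↭ : ∀ {I J} → I ↭ J → catalans I ≡ catalans J
catalans-↭ ↭.refl = refl
catalans-↭ (↭.prep i p) = cong (catalan i *_) (catalans-↭ p)
catalans-↭ (↭.swap {xs = I} i j p) =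
  ≡-trans (lemma (catalan i) (catalan j) (catalans I))
          (cong (λ c → catalan j * (catalan i * c)) (catalans-↭ p))
  where
  lemma : ∀ x y z → x * (y * z) ≡ y * (x * z)
  lemma = solve-∀
catalans-↭ (↭.trans p q) = ≡-trans (catalans-↭ p) (catalans-↭ q)

doubleAreaSum-↭ : ∀ {I J} → I ↭ J → doubleAreaSum I ≡ doubleAreaSum J
doubleAreaSum-↭ ↭.refl = refl
doubleAreaSum-↭ (↭.prep i p) =
  cong₂ (λ c s → doubleAreas i * c + catalan i * s) (catalans-↭ p) (doubleAreaSum-↭ p)
doubleAreaSum-↭ (↭.swap {xs = I} i j p) =
  ≡-trans
    (lemma (doubleAreas i) (catalan i) (doubleAreas j) (catalan j) (catalans I) (doubleAreaSum I))
    (cong₂ (λ c s → doubleAreas j * (catalan i * c) +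
                    catalan j * (doubleAreas i * c + catalan i * s))
           (catalans-↭ p) (doubleAreaSum-↭ p))
  where
  lemma : ∀ a c a′ c′ x y →
    a * (c′ * x) + c * (a′ * x + c′ * y) ≡ a′ * (c * x) + c′ * (a * x + c * y)
  lemma = solve-∀
doubleAreaSum-↭ (↭.trans p q) = ≡-trans (doubleAreaSum-↭ p) (doubleAreaSum-↭ q)

-- Twice the coefficient of degree k at coset type I + (1, …, 1), where
-- c = k + 1 - ΣI; only c ≤ 2 matters.
val : ℕ → List ℕ → ℕ
val 1 I = 2 * catalans I
val 2 I = doubleAreaSum I
val _ I = 0

val-↭ : ∀ c {I J} → I ↭ J → val c I ≡ val c J
val-↭ 0 p = refl
val-↭ 1 p = cong (2 *_) (catalans-↭ p)
val-↭ 2 p = doubleAreaSum-↭ p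
val-↭ (suc (suc (suc _))) p = refl

val-zero : ∀ c I → val c (0 ∷ I) ≡ val c I
val-zero 0 I = refl
val-zero 1 I = cong (2 *_) (*-identityˡ (catalans I))
val-zero 2 I = *-identityˡ (doubleAreaSum I)
val-zero (suc (suc (suc _))) I = refl

-- The recursion that transpositions with the largest point impose on the coefficients. For `c = 2`
-- it is the product rule for areas, whose extra term is `val 1` thanks to the factor 2 there. The
-- bound cannot be dropped: `val 3` is 0, but its predecessor `val 2` is not.
val-suc : ∀ c q I → c ≤ 2 → val c (suc q ∷ I) ≡
  splits (λ a b → val c (a ∷ b ∷ I)) (suc q) + suc q * val (pred c) (suc q ∷ I)
val-suc 0 q I _ = sym (cong₂ _+_ (splits-* 0 (λ _ _ → 0) (suc q)) (*-zeroʳ q))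
val-suc 1 q I _ = begin
  2 * (catalan (suc q) * catalans I)
    ≡⟨ cong (λ c → 2 * (c * catalans I)) (catalan-suc q) ⟩
  2 * (splits C² (suc q) * catalans I)
    ≡⟨ lemma₁ (splits C² (suc q)) (catalans I) ⟩
  2 * catalans I * splits C² (suc q)
    ≡⟨ sym (splits-* (2 * catalans I) C² (suc q)) ⟩
  splits (λ a b → 2 * catalans I * (catalan a * catalan b)) (suc q)
    ≡⟨ splits-cong {H = λ a b → 2 * catalans I * C² a b} (suc q)
         (λ a b _ → lemma₂ (catalans I) (catalan a) (catalan b)) ⟩
  splits (λ a b → val 1 (a ∷ b ∷ I)) (suc q)
    ≡⟨ sym (≡-trans (cong (splits (λ a b → val 1 (a ∷ b ∷ I)) (suc q) +_) (*-zeroʳ q))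
                    (+-identityʳ _)) ⟩
  splits (λ a b → val 1 (a ∷ b ∷ I)) (suc q) + suc q * 0 ∎
  where
  open ≡-Reasoning
  C² : ℕ → ℕ → ℕ
  C² a b = catalan a * catalan b
  lemma₁ : ∀ s c → 2 * (s * c) ≡ 2 * c * s
  lemma₁ = solve-∀
  lemma₂ : ∀ c x y → 2 * c * (x * y) ≡ 2 * (x * (y * c))
  lemma₂ = solve-∀
val-suc 2 q I _ = begin
  doubleAreas (suc q) * catalans I + catalan (suc q) * doubleAreaSum I
    ≡⟨ cong (λ d → d * catalans I + catalan (suc q) * doubleAreaSum I) (doubleAreas-suc q) ⟩
  (sA + 2 * suc q * catalan (suc q)) * catalans I + catalan (suc q) * doubleAreaSum I
    ≡⟨ lemma₁ sA (suc q) (catalan (suc q)) (catalans I) _ ⟩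
  (catalans I * sA + doubleAreaSum I * catalan (suc q)) + suc q * (2 * (catalan (suc q) * catalans I))
    ≡⟨ cong (_+ suc q * (2 * (catalan (suc q) * catalans I))) (begin
      catalans I * sA + doubleAreaSum I * catalan (suc q)
        ≡⟨ cong (λ c → catalans I * sA + doubleAreaSum I * c) (catalan-suc q) ⟩
      catalans I * sA + doubleAreaSum I * splits C² (suc q)
        ≡⟨ cong (_+ doubleAreaSum I * splits C² (suc q)) (sym (splits-* (catalans I) AC (suc q))) ⟩
      splits (λ a b → catalans I * AC a b) (suc q) + doubleAreaSum I * splits C² (suc q)
        ≡⟨ sym (splits-+* (λ a b → catalans I * AC a b) (doubleAreaSum I) C² (suc q)) ⟩
      splits (λ a b → catalans I * AC a b + doubleAreaSum I * C² a b) (suc q)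
        ≡⟨ splits-cong {H = λ a b → catalans I * AC a b + doubleAreaSum I * C² a b} (suc q)
             (λ a b _ → lemma₂ (catalans I) (doubleAreaSum I)
               (doubleAreas a) (catalan a) (doubleAreas b) (catalan b)) ⟩
      splits (λ a b → val 2 (a ∷ b ∷ I)) (suc q) ∎) ⟩
  splits (λ a b → val 2 (a ∷ b ∷ I)) (suc q) + suc q * val 1 (suc q ∷ I) ∎
  where
  open ≡-Reasoning
  AC C² : ℕ → ℕ → ℕ
  AC a b = doubleAreas a * catalan b + catalan a * doubleAreas b
  C² a b = catalan a * catalan b
  sA = splits AC (suc q)
  lemma₁ : ∀ s q c k d → (s + 2 * q * c) * k + c * d ≡ (k * s + d * c) + q * (2 * (c * k))
  lemma₁ = solve-∀
  lemma₂ : ∀ k s d c d′ c′ → k * (d * c′ + c * d′) + s * (c * c′) ≡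
    d * (c′ * k) + c * (d′ * k + c′ * s)
  lemma₂ = solve-∀
val-suc (suc (suc (suc _))) q I (s≤s (s≤s ()))

-- Dyck paths with prescribed returns

filter-map : ∀ {X Y : Set} {P : Pred Y 0ℓ} {Q : Pred X 0ℓ} (P? : Decidable P) (Q? : Decidable Q)
  (f : X → Y) → (∀ x → P (f x) → Q x) → (∀ x → Q x → P (f x)) →
  ∀ xs → filter P? (map f xs) ≡ map f (filter Q? xs)
filter-map P? Q? f to from [] = refl
filter-map P? Q? f to from (x ∷ xs) with P? (f x) | Q? x
... | yes p | yes q = cong (f x ∷_) (filter-map P? Q? f to from xs)
... | yes p | no ¬q = contradiction (to x p) ¬q
... | no ¬p | yes q = contradiction (from x q) ¬p
... | no ¬p | no ¬q = filter-map P? Q? f to from xs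

Returns : ∀ {a l b} → List ℕ → Path a l b → Set
Returns ts π = All (λ t → heightAfter t π ≡ 0) ts

returns? : ∀ {a l b} ts (π : Path a l b) → Dec (Returns ts π)
returns? ts π = all? (λ t → heightAfter t π ≟ 0) ts

returning : ∀ a l → List ℕ → List (Path a l 0)
returning a l ts = filter (returns? ts) (paths a l 0)

totalArea : ∀ {a l} → List (Path a l 0) → ℕ
totalArea πs = sum (map doubleArea πs)

later : List ℕ → List ℕ
later = map suc

returning-up : ∀ {a l} ts (πs : List (Path (suc a) l 0)) →
  filter (returns? (later ts)) (map up πs) ≡ map up (filter (returns? ts) πs)
returning-up ts = filter-map _ _ up (λ π → to ts) (λ π → from ts)
  where
  to : ∀ {a l} {π : Path (suc a) l 0} ts → Returns (later ts) (up π) → Returns ts π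
  to []       []      = []
  to (t ∷ ts) (e ∷ r) = e ∷ to ts r
  from : ∀ {a l} {π : Path (suc a) l 0} ts → Returns ts π → Returns (later ts) (up π)
  from []       []      = []
  from (t ∷ ts) (e ∷ r) = e ∷ from ts r

returning-down : ∀ {a l} ts (πs : List (Path a l 0)) →
  filter (returns? (later ts)) (map down πs) ≡ map down (filter (returns? ts) πs)
returning-down ts = filter-map _ _ down (λ π → to ts) (λ π → from ts)
  where
  to : ∀ {a l} {π : Path a l 0} ts → Returns (later ts) (down π) → Returns ts π
  to []       []      = []
  to (t ∷ ts) (e ∷ r) = e ∷ to ts r
  from : ∀ {a l} {π : Path a l 0} ts → Returns ts π → Returns (later ts) (down π)
  from []       []      = []
  from (t ∷ ts) (e ∷ r) = e ∷ from ts r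

totalArea-++ : ∀ {a l} (πs ρs : List (Path a l 0)) →
  totalArea (πs ++ ρs) ≡ totalArea πs + totalArea ρs
totalArea-++ πs ρs = ≡-trans (cong sum (map-++ doubleArea πs ρs)) (sum-++ (map doubleArea πs) _)

totalArea-step : ∀ {a l a′ l′} (f : Path a l 0 → Path a′ l′ 0) c →
  (∀ π → doubleArea (f π) ≡ c + doubleArea π) →
  ∀ πs → totalArea (map f πs) ≡ totalArea πs + c * length πs
totalArea-step f c e []       = sym (*-zeroʳ c)
totalArea-step f c e (π ∷ πs) =
  ≡-trans (cong₂ _+_ (e π) (totalArea-step f c e πs))
          (lemma c (doubleArea π) (totalArea πs) (length πs))
  where
  lemma : ∀ c d t l → c + d + (t + c * l) ≡ d + t + c * suc l
  lemma = solve-∀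

infix  4 _,,_
infixl 6 _⊕_

-- Number and area have to be computed together: prepending a step adds its own double area once for
-- every path.
record Totals : Set where
  constructor _,,_
  field
    number total : ℕ

totals : ∀ {a l} → List (Path a l 0) → Totals
totals πs = length πs ,, totalArea πs

_⊕_ : Totals → Totals → Totals
(n ,, d) ⊕ (n′ ,, d′) = (n + n′) ,, (d + d′)

shifted : ℕ → Totals → Totals
shifted c (n ,, d) = n ,, (d + c * n)

totals-map : ∀ {a l a′ l′} (f : Path a l 0 → Path a′ l′ 0) c →
  (∀ π → doubleArea (f π) ≡ c + doubleArea π) →
  ∀ πs → totals (map f πs) ≡ shifted c (totals πs)
totals-map f c e πs = cong₂ _,,_ (length-map f πs) (totalArea-step f c e πs)

totals-++ : ∀ {a l} (πs ρs : List (Path a l 0)) → totals (πs ++ ρs) ≡ totals πs ⊕ totals ρs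
totals-++ πs ρs = cong₂ _,,_ (length-++ πs) (totalArea-++ πs ρs)

R : ℕ → ℕ → List ℕ → Totals
R a l ts = totals (returning a l ts)

R-ground : ∀ l ts → R 0 (suc l) (later ts) ≡ shifted 1 (R 1 l ts)
R-ground l ts = ≡-trans (cong totals (returning-up ts (paths 1 l 0)))
                        (totals-map up 1 (λ π → refl) (returning 1 l ts))

R-step : ∀ a l ts → R (suc a) (suc l) (later ts) ≡
  shifted (suc a + suc (suc a)) (R (2 + a) l ts) ⊕ shifted (suc a + a) (R a l ts)
R-step a l ts = begin
  totals (filter (returns? (later ts)) (map up ups ++ map down downs))
    ≡⟨ cong totals (filter-++ (returns? (later ts)) (map up ups) (map down downs)) ⟩
  totals (filter (returns? (later ts)) (map up ups) ++ filter (returns? (later ts)) (map down downs))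
    ≡⟨ cong₂ (λ x y → totals (x ++ y)) (returning-up ts ups) (returning-down ts downs) ⟩
  totals (map up (returning (2 + a) l ts) ++ map down (returning a l ts))
    ≡⟨ totals-++ (map up (returning (2 + a) l ts)) _ ⟩
  totals (map up (returning (2 + a) l ts)) ⊕ totals (map down (returning a l ts))
    ≡⟨ cong₂ _⊕_ (totals-map up _ (λ π → refl) (returning (2 + a) l ts))
                 (totals-map down _ (λ π → refl) (returning a l ts)) ⟩
  shifted (suc a + suc (suc a)) (R (2 + a) l ts) ⊕ shifted (suc a + a) (R a l ts) ∎
  where
  open ≡-Reasoning
  ups   = paths (2 + a) l 0
  downs = paths a l 0

R-now-ground : ∀ l ts → R 0 l (0 ∷ ts) ≡ R 0 l ts
R-now-ground l ts = cong totals (go (paths 0 l 0))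
  where
  go : ∀ πs → filter (returns? (0 ∷ ts)) πs ≡ filter (returns? ts) πs
  go []       = refl
  go (π ∷ πs) with returns? (0 ∷ ts) π | returns? ts π
  ... | yes p | yes q = cong (π ∷_) (go πs)
  ... | yes (_ ∷ p) | no ¬q = contradiction p ¬q
  ... | no ¬p | yes q = contradiction (refl ∷ q) ¬p
  ... | no ¬p | no ¬q = go πs

R-now-high : ∀ a l ts → R (suc a) l (0 ∷ ts) ≡ (0 ,, 0)
R-now-high a l ts = cong totals (go (paths (suc a) l 0))
  where
  go : ∀ πs → filter (returns? (0 ∷ ts)) πs ≡ []
  go []       = refl
  go (π ∷ πs) with returns? (0 ∷ ts) π
  ... | yes (() ∷ _)
  ... | no _ = go πs

short : ∀ a l → l < a → R a l [] ≡ (0 ,, 0)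
short (suc a) zero    _         = refl
short (suc a) (suc l) (s≤s l<a) =
  ≡-trans (R-step a l [])
    (≡-trans (cong₂ (λ x y → shifted (suc a + suc (suc a)) x ⊕ shifted (suc a + a) y)
               (short (2 + a) l (<-trans l<a (<-trans (n<1+n a) (n<1+n (suc a))))) (short a l l<a))
             (cong (0 ,,_) (lemma a)))
  where
  lemma : ∀ a → (suc a + suc (suc a)) * 0 + (suc a + a) * 0 ≡ 0
  lemma = solve-∀

-- A path of length `a + 2 * u` from height `a` to the ground has `u` up-steps. For `u = 0` the
-- branch that goes up is too short to come down again, and `short` removes it.
R-closed : ∀ l a u → l ≡ a + 2 * u → R a l [] ≡ (N a u ,, A a u)
R-closed zero    zero    zero    e = refl
R-closed (suc l) zero    (suc u) e =
  ≡-trans (R-ground l [])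
    (≡-trans (cong (shifted 1) (R-closed l 1 u (≡-trans (suc-injective e) (+-suc u (u + 0)))))
      (cong (N 1 u ,,_) (cong (A 1 u +_) (*-identityˡ (N 1 u)))))
R-closed (suc l) (suc a) zero    e =
  ≡-trans (R-step a l [])
    (≡-trans (cong₂ (λ x y → shifted (suc a + suc (suc a)) x ⊕ shifted (suc a + a) y)
               (short (2 + a) l l<2+a) (R-closed l a 0 (suc-injective e)))
             (cong (N a 0 ,,_) (lemma a (A a 0) (N a 0))))
  where
  l<2+a : l < 2 + a
  l<2+a = subst (_< 2 + a) (sym (≡-trans (suc-injective e) (+-identityʳ a)))
                (<-trans (n<1+n a) (n<1+n (suc a)))
  lemma : ∀ a d m → (suc a + suc (suc a)) * 0 + (d + (suc a + a) * m) ≡ d + (2 * a + 1) * m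
  lemma = solve-∀
R-closed (suc l) (suc a) (suc u) e =
  ≡-trans (R-step a l [])
    (≡-trans (cong₂ (λ x y → shifted (suc a + suc (suc a)) x ⊕ shifted (suc a + a) y)
               (R-closed l (2 + a) u (≡-trans (suc-injective e) (lemma₀ a u)))
               (R-closed l a (suc u) (suc-injective e)))
             (cong (N (suc a) (suc u) ,,_)
               (lemma a (A (2 + a) u) (N (2 + a) u) (A a (suc u)) (N a (suc u)))))
  where
  lemma₀ : ∀ a u → a + 2 * suc u ≡ 2 + a + 2 * u
  lemma₀ = solve-∀
  lemma : ∀ a d m d′ m′ →
    (d + (suc a + suc (suc a)) * m) + (d′ + (suc a + a) * m′) ≡
    (d + (2 * a + 3) * m) + (d′ + (2 * a + 1) * m′)
  lemma = solve-∀

-- Continuing each path by an independent one with the returns of `I` multiplies the numbers; the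
-- areas follow the product rule.
after : Totals → List ℕ → Totals
after (n ,, d) I = (n * catalans I) ,, (d * catalans I + n * doubleAreaSum I)

after-shifted : ∀ c x I → shifted c (after x I) ≡ after (shifted c x) I
after-shifted c (n ,, d) I = cong (n * catalans I ,,_) (lemma c n d (catalans I) (doubleAreaSum I))
  where
  lemma : ∀ c n d k s → d * k + n * s + c * (n * k) ≡ (d + c * n) * k + n * s
  lemma = solve-∀

after-⊕ : ∀ x y I → after x I ⊕ after y I ≡ after (x ⊕ y) I
after-⊕ (n ,, d) (n′ ,, d′) I = cong₂ _,,_ (sym (*-distribʳ-+ (catalans I) n n′))
  (lemma n d n′ d′ (catalans I) (doubleAreaSum I))
  where
  lemma : ∀ n d n′ d′ k s →
    (d * k + n * s) + (d′ * k + n′ * s) ≡ (d + d′) * k + (n + n′) * s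
  lemma = solve-∀

later-returnTimes : ∀ t I → returnTimes (suc t) I ≡ later (returnTimes t I)
later-returnTimes t []      = refl
later-returnTimes t (i ∷ I) = cong (suc (t + 2 * i) ∷_) (later-returnTimes (t + 2 * i) I)

R-returnTimes₀ : ∀ l I → l ≡ 2 * sum I → R 0 l (returnTimes 0 I) ≡ (catalans I ,, doubleAreaSum I)
-- Induction on the time `t` left until the next prescribed return. Until then `after` commutes with
-- prepending a step; at time 0 a path on the ground starts afresh, and one above the ground is
-- discarded.
R-returnTimes  : ∀ I t a l → l ≡ t + 2 * sum I →
  R a l (t ∷ returnTimes t I) ≡ after (R a t []) I

R-returnTimes₀ zero [] e = refl
R-returnTimes₀ l (i ∷ I) e =
  ≡-trans (R-returnTimes I (2 * i) 0 l (≡-trans e (*-distribˡ-+ 2 i (sum I))))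
          (cong (λ x → after x I) (R-closed (2 * i) 0 i refl))

R-returnTimes I zero    zero    l e =
  ≡-trans (R-now-ground l (returnTimes 0 I))
    (≡-trans (R-returnTimes₀ l I e)
      (sym (cong₂ _,,_ (+-identityʳ (catalans I)) (+-identityʳ (doubleAreaSum I)))))
R-returnTimes I zero    (suc a) l e = R-now-high a l (returnTimes 0 I)
R-returnTimes I (suc t) zero    (suc l) e =
  ≡-trans (cong (λ ts → R 0 (suc l) (suc t ∷ ts)) (later-returnTimes t I))
    (≡-trans (R-ground l (t ∷ returnTimes t I))
      (≡-trans (cong (shifted 1) (R-returnTimes I t 1 l (suc-injective e)))
        (≡-trans (after-shifted 1 (R 1 t []) I)
                 (cong (λ x → after x I) (sym (R-ground t []))))))
R-returnTimes I (suc t) (suc a) (suc l) e =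
  ≡-trans (cong (λ ts → R (suc a) (suc l) (suc t ∷ ts)) (later-returnTimes t I))
    (≡-trans (R-step a l (t ∷ returnTimes t I))
      (≡-trans (cong₂ (λ x y → shifted c x ⊕ shifted c′ y)
                  (R-returnTimes I t (2 + a) l (suc-injective e))
                  (R-returnTimes I t a l (suc-injective e)))
        (≡-trans (cong₂ _⊕_ (after-shifted c (R (2 + a) t []) I) (after-shifted c′ (R a t []) I))
          (≡-trans (after-⊕ (shifted c (R (2 + a) t [])) (shifted c′ (R a t [])) I)
                   (cong (λ x → after x I) (sym (R-step a t [])))))))
  where
  c  = suc a + suc (suc a)
  c′ = suc a + a

-- Each step has double area of the form a + (a + 1), which is odd, so double area and length have
-- the same parity.
2∣doubleArea+length : ∀ {a l b} (π : Path a l b) → 2 ∣ doubleArea π + l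
2∣doubleArea+length stop = divides 0 refl
2∣doubleArea+length {a} {suc l} (up π) =
  subst (2 ∣_) (lemma a (doubleArea π) l) (∣m∣n⇒∣m+n (divides (suc a) refl) (2∣doubleArea+length π))
  where
  lemma : ∀ a d l → suc a * 2 + (d + l) ≡ (a + suc a) + d + suc l
  lemma = solve-∀
2∣doubleArea+length {suc a} {suc l} (down π) =
  subst (2 ∣_) (lemma a (doubleArea π) l) (∣m∣n⇒∣m+n (divides (suc a) refl) (2∣doubleArea+length π))
  where
  lemma : ∀ a d l → suc a * 2 + (d + l) ≡ (suc a + a) + d + suc l
  lemma = solve-∀

2*area : ∀ {k} (π : DyckPath k) → 2 * area {k} π ≡ doubleArea π
2*area {k} π = m*[n/m]≡n
  (∣m+n∣m⇒∣n (subst (2 ∣_) (+-comm (doubleArea π) (2 * k)) (2∣doubleArea+length π)) (m∣m*n k))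

2*𝔄 : ∀ I → 2 * 𝔄 I ≡ doubleAreaSum I
2*𝔄 I = ≡-trans (go (𝒫 I)) (cong Totals.total (R-returnTimes₀ (2 * sum I) I refl))
  where
  go : ∀ πs → 2 * sum (map (area {sum I}) πs) ≡ totalArea πs
  go []       = refl
  go (π ∷ πs) = ≡-trans (*-distribˡ-+ 2 (area {sum I} π) _) (cong₂ _+_ (2*area {sum I} π) (go πs))

-- Lists and transpositions

unique-↭ : ∀ {A : Set} {xs ys : List A} → xs ↭ ys → Unique xs → Unique ys
unique-↭ p = ↭ₛ.Unique-resp-↭ (setoid _) (↭⇒↭ₛ p)

unique-set⇒↭ : ∀ {A : Set} {xs ys : List A} → Unique xs → Unique ys →
  (∀ {x} → x ∈ xs → x ∈ ys) → (∀ {x} → x ∈ ys → x ∈ xs) → xs ↭ ys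
unique-set⇒↭ p q f g = ∼bag⇒↭ (unique∧set⇒bag p q (mk⇔ f g))

∉⇒All≢ : ∀ {A : Set} {x : A} xs → x ∉ xs → All (x ≢_) xs
∉⇒All≢ xs x∉ = All.tabulate λ { y∈ refl → x∉ y∈ }

sum-zero : ∀ {A : Set} (f : A → ℕ) xs → (∀ x → x ∈ xs → f x ≡ 0) → sum (map f xs) ≡ 0
sum-zero f []       e = refl
sum-zero f (x ∷ xs) e = cong₂ _+_ (e x (here refl)) (sum-zero f xs λ y y∈ → e y (there y∈))

catalans-trivial : ∀ I → sum I ≡ 0 → catalans I ≡ 1
catalans-trivial []         _ = refl
catalans-trivial (zero ∷ I) e = ≡-trans (*-identityˡ (catalans I)) (catalans-trivial I e)

-- Turns the sum over the entries at which a cycle can be cut into the convolution of `val-suc`: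
-- only the numbers of entries on either side matter.
sum-splits : ∀ {A : Set} (f : A → ℕ) H vs →
  (∀ xs v ys → vs ≡ xs ++ v ∷ ys → f v ≡ H (length xs) (length ys)) →
  sum (map f vs) ≡ splits H (length vs)
sum-splits f H []       e = refl
sum-splits f H (v ∷ vs) e = cong₂ _+_ (e [] v vs refl)
  (sum-splits f (λ a → H (suc a)) vs λ xs w ys eq → e (v ∷ xs) w ys (cong (v ∷_) eq))

splits-constant : ∀ c q → splits (λ _ _ → c) q ≡ q * c
splits-constant c zero    = refl
splits-constant c (suc q) = cong (c +_) (splits-constant c q)

sum-double : ∀ {A : Set} (f : A → ℕ) xs → 2 * sum (map f xs) ≡ sum (map (λ x → 2 * f x) xs)
sum-double f []       = refl
sum-double f (x ∷ xs) = ≡-trans (*-distribˡ-+ 2 (f x) _) (cong (2 * f x +_) (sum-double f xs))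

minimum : ∀ {m} (x : Fin m) xs → ∃ λ y → y ∈ x ∷ xs × (∀ {z} → z ∈ x ∷ xs → y Fin.≤ z)
minimum x [] = x , here refl , λ { (here refl) → ≤-refl }
minimum x (x′ ∷ xs) with minimum x′ xs
... | y , y∈ , y≤ with Finₚ.≤-total x y
...   | inj₁ x≤y = x , here refl , λ { (here refl) → ≤-refl ; (there z∈) → ≤-trans x≤y (y≤ z∈) }
...   | inj₂ y≤x = y , there y∈ , λ { (here refl) → y≤x ; (there z∈) → y≤ z∈ }

unique-++-disjoint : ∀ {A : Set} {x : A} xs {ys} → Unique (xs ++ ys) → x ∈ xs → x ∉ ys
unique-++-disjoint (x ∷ xs) u       (here refl) x∈ = Unique[x∷xs]⇒x∉xs u (∈-++⁺ʳ xs x∈)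
unique-++-disjoint (_ ∷ xs) (_ ∷ u) (there x∈)     = unique-++-disjoint xs u x∈

unique-++ʳ : ∀ {A : Set} (xs : List A) {ys} → Unique (xs ++ ys) → Unique ys
unique-++ʳ []       u       = u
unique-++ʳ (x ∷ xs) (_ ∷ u) = unique-++ʳ xs u

unique-++ˡ : ∀ {A : Set} (xs : List A) {ys} → Unique (xs ++ ys) → Unique xs
unique-++ˡ []       u       = []
unique-++ˡ (x ∷ xs) (x≢ ∷ u) = Allₚ.++⁻ˡ xs x≢ ∷ unique-++ˡ xs u

module _ {m : ℕ} (i j : Fin m) where

  transpose-left : transpose i j ⟨$⟩ʳ i ≡ j
  transpose-left rewrite dec-true (i Finₚ.≟ i) refl = refl

  transpose-right : transpose i j ⟨$⟩ʳ j ≡ i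
  transpose-right with j Finₚ.≟ i
  ... | yes j≡i = j≡i
  ... | no  _ rewrite dec-true (j Finₚ.≟ j) refl = refl

  transpose-other : ∀ {k} → k ≢ i → k ≢ j → transpose i j ⟨$⟩ʳ k ≡ k
  transpose-other {k} k≢i k≢j
    rewrite dec-false (k Finₚ.≟ i) k≢i | dec-false (k Finₚ.≟ j) k≢j = refl

-- Points, their blocks {i, ī}, and sums over the earlier points

module Points (n : ℕ) where

  block : Point n → Fin n
  block v = proj₁ (remQuot {n} 2 v)

  block-plain : ∀ i → block (plain n i) ≡ i
  block-plain i = cong proj₁ (Finₚ.remQuot-combine i 0F)

  private
    flipped : Fin n × Fin 2 → Point n
    flipped (i , e) = combine i (opposite e)

  bar-plain : ∀ i → bar n (plain n i) ≡ barred n i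
  bar-plain i = cong flipped (Finₚ.remQuot-combine i 0F)

  bar-barred : ∀ i → bar n (barred n i) ≡ plain n i
  bar-barred i = cong flipped (Finₚ.remQuot-combine i 1F)

  plain-or-barred : ∀ v → v ≡ plain n (block v) ⊎ v ≡ barred n (block v)
  plain-or-barred v =
    cases (block v) (proj₂ (remQuot {n} 2 v)) (Finₚ.combine-remQuot {n} 2 v)
    where
    cases : ∀ i e → combine i e ≡ v → v ≡ plain n i ⊎ v ≡ barred n i
    cases i 0F e = inj₁ (sym e)
    cases i 1F e = inj₂ (sym e)

  bar-involutive : ∀ v → bar n (bar n v) ≡ v
  bar-involutive v with plain-or-barred v
  ... | inj₁ e = ≡-trans (cong (bar n ∘ bar n) e)
                   (≡-trans (cong (bar n) (bar-plain _)) (≡-trans (bar-barred _) (sym e)))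
  ... | inj₂ e = ≡-trans (cong (bar n ∘ bar n) e)
                   (≡-trans (cong (bar n) (bar-barred _)) (≡-trans (bar-plain _) (sym e)))

  block-barred : ∀ i → block (barred n i) ≡ i
  block-barred i = cong proj₁ (Finₚ.remQuot-combine i 1F)

  block-bar : ∀ v → block (bar n v) ≡ block v
  block-bar v with plain-or-barred v
  ... | inj₁ e = ≡-trans (cong (block ∘ bar n) e)
                   (≡-trans (cong block (bar-plain _)) (block-barred _))
  ... | inj₂ e = ≡-trans (cong (block ∘ bar n) e)
                   (≡-trans (cong block (bar-barred _)) (block-plain _))

  plain≢barred : ∀ i → plain n i ≢ barred n i
  plain≢barred i e with () ← Finₚ.combine-injectiveʳ i 0F i 1F e

  bar≢ : ∀ v → bar n v ≢ v
  bar≢ v e with plain-or-barred v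
  ... | inj₁ p = plain≢barred (block v)
    (≡-trans (sym p) (≡-trans (sym e) (≡-trans (cong (bar n) p) (bar-plain _))))
  ... | inj₂ p = plain≢barred (block v)
    (≡-trans (sym (≡-trans (cong (bar n) p) (bar-barred _))) (≡-trans e p))

  same-block : ∀ {v w} → block w ≡ block v → w ≡ v ⊎ w ≡ bar n v
  same-block {v} {w} e with plain-or-barred v | plain-or-barred w
  ... | inj₁ p | inj₁ q = inj₁ (≡-trans q (≡-trans (cong (plain n) e) (sym p)))
  ... | inj₂ p | inj₂ q = inj₁ (≡-trans q (≡-trans (cong (barred n) e) (sym p)))
  ... | inj₁ p | inj₂ q = inj₂ (≡-trans q (≡-trans (cong (barred n) e)
                            (sym (≡-trans (cong (bar n) p) (bar-plain _)))))
  ... | inj₂ p | inj₁ q = inj₂ (≡-trans q (≡-trans (cong (plain n) e)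
                            (sym (≡-trans (cong (bar n) p) (bar-barred _)))))

  both : List (Point n) → List (Point n)
  both []       = []
  both (v ∷ vs) = v ∷ bar n v ∷ both vs

  length-both : ∀ vs → length (both vs) ≡ 2 * length vs
  length-both []       = refl
  length-both (v ∷ vs) = ≡-trans (cong (suc ∘ suc) (length-both vs)) (sym (*-suc 2 (length vs)))

  ∈-both⁻ : ∀ {w} vs → w ∈ both vs → block w ∈ map block vs
  ∈-both⁻ (v ∷ vs) (here refl)         = here refl
  ∈-both⁻ (v ∷ vs) (there (here refl)) = here (block-bar v)
  ∈-both⁻ (v ∷ vs) (there (there w∈))  = there (∈-both⁻ vs w∈)

  ∈-both⁺ : ∀ {w} vs → block w ∈ map block vs → w ∈ both vs
  ∈-both⁺ (v ∷ vs) (here e) with same-block {v} e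
  ... | inj₁ w≡v = here w≡v
  ... | inj₂ w≡v = there (here w≡v)
  ∈-both⁺ (v ∷ vs) (there w∈) = there (there (∈-both⁺ vs w∈))

  unique-both : ∀ vs → Unique (map block vs) → Unique (both vs)
  unique-both []       _         = []
  unique-both (v ∷ vs) u@(_ ∷ u′) =
    ((bar≢ v ∘ sym) ∷ ∉⇒All≢ (both vs) (v∉ ∘ ∈-both⁻ vs)) ∷
    ∉⇒All≢ (both vs) (λ w∈ → v∉ (subst (_∈ _) (block-bar v) (∈-both⁻ vs w∈))) ∷
    unique-both vs u′
    where v∉ = Unique[x∷xs]⇒x∉xs u

  -- Decreasing like the variables of `hJ`, so that giving up the largest variable is taking the
  -- tail. The bound is irrelevant, so lists built from different proofs of it coincide.
  below : ∀ m → .(m ≤ n) → List (Fin n)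
  below zero    _   = []
  below (suc m) m<n = fromℕ< m<n ∷ below m (<⇒≤ m<n)

  ∈-below⁻ : ∀ {j} m .(m≤n : m ≤ n) → j ∈ below m m≤n → toℕ j < m
  ∈-below⁻ (suc m) m<n (here refl) = subst (_< suc m) (sym (Finₚ.toℕ-fromℕ< m<n)) (s≤s ≤-refl)
  ∈-below⁻ (suc m) m<n (there j∈)  = m<n⇒m<1+n (∈-below⁻ m (<⇒≤ m<n) j∈)

  ∈-below⁺ : ∀ {j} m .(m≤n : m ≤ n) → toℕ j < m → j ∈ below m m≤n
  ∈-below⁺ {j} (suc m) m<n j<1+m with m<1+n⇒m<n∨m≡n j<1+m
  ... | inj₁ j<m = there (∈-below⁺ m (<⇒≤ m<n) j<m)
  ... | inj₂ j≡m = here (Finₚ.toℕ-injective (≡-trans j≡m (sym (Finₚ.toℕ-fromℕ< m<n))))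

  unique-below : ∀ m .(m≤n : m ≤ n) → Unique (below m m≤n)
  unique-below zero    _   = []
  unique-below (suc m) m<n =
    ∉⇒All≢ _ (λ i∈ → <-irrefl (Finₚ.toℕ-fromℕ< m<n) (∈-below⁻ m (<⇒≤ m<n) i∈)) ∷
    unique-below m (<⇒≤ m<n)

  <-plain⁺ : ∀ {v i} → block v Fin.< i → v Fin.< plain n i
  <-plain⁺ {v} {i} lt with plain-or-barred v
  ... | inj₁ e = subst (Fin._< plain n i) (sym e) (Finₚ.combine-monoˡ-< 0F 0F lt)
  ... | inj₂ e = subst (Fin._< plain n i) (sym e) (Finₚ.combine-monoˡ-< 1F 0F lt)

  <-plain⁻ : ∀ {v i} → v Fin.< plain n i → block v Fin.< i
  <-plain⁻ {v} {i} v<i = ≰⇒> λ i≤v → <⇒≱ v<i (subst (toℕ (plain n i) ≤_) v≡ (begin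
    toℕ (plain n i)                          ≡⟨ Finₚ.toℕ-combine i 0F ⟩
    2 * toℕ i + 0                            ≤⟨ +-mono-≤ (*-monoʳ-≤ 2 i≤v) z≤n ⟩
    2 * toℕ (block v) + toℕ (proj₂ (remQuot {n} 2 v))
                                             ≡⟨ sym (Finₚ.toℕ-combine (block v) (proj₂ (remQuot {n} 2 v))) ⟩
    toℕ (combine (block v) (proj₂ (remQuot {n} 2 v))) ∎))
    where
    open ≤-Reasoning
    v≡ : toℕ (combine (block v) (proj₂ (remQuot {n} 2 v))) ≡ toℕ v
    v≡ = cong toℕ (Finₚ.combine-remQuot {n} 2 v)

  earlier : Fin n → List (Point n)
  earlier i = filter (Finₚ._<? plain n i) (allFin (n * 2))

  pairs : (Point n → ℕ) → Fin n → ℕ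
  pairs g j = g (plain n j) + g (barred n j)

  sum-pairs : ∀ g L → sum (map g (both (map (plain n) L))) ≡ sum (map (pairs g) L)
  sum-pairs g []      = refl
  sum-pairs g (j ∷ L) = ≡-trans (sym (+-assoc (g (plain n j)) _ _))
    (cong₂ _+_ (cong (λ v → g (plain n j) + g v) (bar-plain j)) (sum-pairs g L))

  map-block-plain : ∀ L → map block (map (plain n) L) ≡ L
  map-block-plain []      = refl
  map-block-plain (j ∷ L) = cong₂ _∷_ (block-plain j) (map-block-plain L)

  -- Grouping by blocks prepares for the two ends of a solid edge acting differently: on the cycle
  -- of the largest point, one of them splits it and the other reverses a stretch.
  sum-earlier : ∀ m .(m<n : m < n) g →
    sum (map g (earlier (fromℕ< m<n))) ≡ sum (map (pairs g) (below m (<⇒≤ m<n)))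
  sum-earlier m m<n g = ≡-trans
    (sum-↭ (map-↭ g (unique-set⇒↭ (filter⁺ _ (allFin⁺ (n * 2)))
                                  (unique-both _ (subst Unique (sym (map-block-plain L)) (unique-below m _)))
                                  to from)))
    (sum-pairs g L)
    where
    L = below m (<⇒≤ m<n)
    i = fromℕ< m<n
    to : ∀ {v} → v ∈ earlier i → v ∈ both (map (plain n) L)
    to {v} v∈ = ∈-both⁺ _ (subst (block v ∈_) (sym (map-block-plain L))
      (∈-below⁺ m _ (subst (toℕ (block v) <_) (Finₚ.toℕ-fromℕ< m<n)
        (<-plain⁻ (proj₂ (∈-filter⁻ (Finₚ._<? plain n i) {xs = allFin (n * 2)} v∈))))))
    from : ∀ {v} → v ∈ both (map (plain n) L) → v ∈ earlier i
    from {v} v∈ = ∈-filter⁺ (Finₚ._<? plain n i) (∈-allFin v)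
      (<-plain⁺ (subst (toℕ (block v) <_) (sym (Finₚ.toℕ-fromℕ< m<n))
        (∈-below⁻ m _ (subst (block v ∈_) (map-block-plain L) (∈-both⁻ _ v∈)))))

  sum-pairs-points : ∀ g vs → sum (map (pairs g) (map block vs)) ≡ sum (map (λ v → g v + g (bar n v)) vs)
  sum-pairs-points g []       = refl
  sum-pairs-points g (v ∷ vs) = cong₂ _+_ (head v) (sum-pairs-points g vs)
    where
    head : ∀ v → pairs g (block v) ≡ g v + g (bar n v)
    head v with plain-or-barred v
    ... | inj₁ e = cong₂ (λ x y → g x + g y) (sym e)
                     (sym (≡-trans (cong (bar n) e) (bar-plain _)))
    ... | inj₂ e = ≡-trans (+-comm (g (plain n (block v))) _)
                     (cong₂ (λ x y → g x + g y) (sym e)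
                       (sym (≡-trans (cong (bar n) e) (bar-barred _))))

-- Cycles of solid and dashed edges

module Matchings (n : ℕ) where
  open Points n

  -- x and y are joined by a dashed edge of G_σ.
  Dash : Permutation′ (n * 2) → Point n → Point n → Set
  Dash σ x y = σ ⟨$⟩ˡ y ≡ bar n (σ ⟨$⟩ˡ x)

  dash-sym : ∀ σ {x y} → Dash σ x y → Dash σ y x
  dash-sym σ {x} e = ≡-trans (sym (bar-involutive (σ ⟨$⟩ˡ x))) (cong (bar n) (sym e))

  from-injective : ∀ (σ : Permutation′ (n * 2)) {x y} → σ ⟨$⟩ˡ x ≡ σ ⟨$⟩ˡ y → x ≡ y
  from-injective σ e = ≡-trans (sym (inverseʳ σ)) (≡-trans (cong (σ ⟨$⟩ʳ_) e) (inverseʳ σ))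

  dash-unique : ∀ σ {x y z} → Dash σ x y → Dash σ x z → y ≡ z
  dash-unique σ d e = from-injective σ (≡-trans d (sym e))

  -- Walk σ v vs w: v, bar v, v₁, bar v₁, …, w alternates between solid and
  -- dashed edges, where vs = v₁, v₂, … .
  data Walk (σ : Permutation′ (n * 2)) : Point n → List (Point n) → Point n → Set where
    [_] : ∀ {v w} → Dash σ (bar n v) w → Walk σ v [] w
    _∷_ : ∀ {v x xs w} → Dash σ (bar n v) x → Walk σ x xs w → Walk σ v (x ∷ xs) w

  module _ {σ : Permutation′ (n * 2)} where

    walk-++ : ∀ {v x w} xs {ys} → Walk σ v xs x → Walk σ x ys w → Walk σ v (xs ++ x ∷ ys) w
    walk-++ []       [ d ]   q = d ∷ q
    walk-++ (_ ∷ xs) (d ∷ p) q = d ∷ walk-++ xs p q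

    walk-split : ∀ {v x w} xs {ys} → Walk σ v (xs ++ x ∷ ys) w → Walk σ v xs x × Walk σ x ys w
    walk-split []       (d ∷ q) = [ d ] , q
    walk-split (_ ∷ xs) (d ∷ p) with p₁ , p₂ ← walk-split xs p = d ∷ p₁ , p₂

  -- The list for the walk traversed backwards: each solid edge is now entered at its other end.
  reflect : List (Point n) → List (Point n)
  reflect []       = []
  reflect (x ∷ xs) = reflect xs ++ bar n x ∷ []

  walk-reflect : ∀ {σ v w} xs → Walk σ v xs w → Walk σ (bar n w) (reflect xs) (bar n v)
  walk-reflect {σ} {v} {w} [] [ d ] =
    [ subst (λ x → Dash σ x (bar n v)) (sym (bar-involutive w)) (dash-sym σ d) ]
  walk-reflect {σ} {v} {w} (x ∷ xs) (d ∷ p) = walk-++ (reflect xs) (walk-reflect xs p)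
    [ subst (λ y → Dash σ y (bar n v)) (sym (bar-involutive x)) (dash-sym σ d) ]

  length-reflect : ∀ xs → length (reflect xs) ≡ length xs
  length-reflect []       = refl
  length-reflect (x ∷ xs) = ≡-trans (length-++ (reflect xs))
    (≡-trans (+-comm (length (reflect xs)) 1) (cong suc (length-reflect xs)))

  blocks-reflect : ∀ xs → map block (reflect xs) ↭ map block xs
  blocks-reflect []       = ↭-refl
  blocks-reflect (x ∷ xs) =
    ↭-trans (↭-reflexive (≡-trans (map-++ block (reflect xs) (bar n x ∷ []))
                                  (cong (λ j → map block (reflect xs) ++ j ∷ []) (block-bar x))))
    (↭-trans (++-comm (map block (reflect xs)) (block x ∷ [])) (prep (block x) (blocks-reflect xs)))

  blocks-insert : ∀ xs x (ys : List (Point n)) →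
    map block (xs ++ x ∷ ys) ↭ block x ∷ map block xs ++ map block ys
  blocks-insert xs x ys = ↭-trans (↭-reflexive (map-++ block xs (x ∷ ys)))
                                  (shift (block x) (map block xs) (map block ys))

  -- A cycle v, bar v, v₁, bar v₁, … is represented by (v , v₁ ∷ …); it has one
  -- more solid edge than the list has entries.
  Cycle : Set
  Cycle = Point n × List (Point n)

  IsCycle : Permutation′ (n * 2) → Cycle → Set
  IsCycle σ (v , vs) = Walk σ v vs v

  blocks : List Cycle → List (Fin n)
  blocks []             = []
  blocks ((v , vs) ∷ D) = map block (v ∷ vs) ++ blocks D

  sizes : List Cycle → List ℕ
  sizes = map (length ∘ proj₂)

  -- A cycle lists only the end at which each solid edge is entered. If `s` is the other end, the
  -- cycle has to be traversed backwards to start at `s`.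
  rotate : ∀ {σ v vs} s → IsCycle σ (v , vs) → block s ∈ map block (v ∷ vs) →
    ∃ λ vs′ → IsCycle σ (s , vs′) × map block (s ∷ vs′) ↭ map block (v ∷ vs) × length vs′ ≡ length vs
  rotate {σ} {v} {vs} s c (here e) with same-block {v = v} {s} e
  ... | inj₁ refl = vs , c , ↭-refl , refl
  ... | inj₂ refl = reflect vs , walk-reflect vs c ,
    ↭-trans (↭-reflexive (cong (_∷ map block (reflect vs)) (block-bar v)))
            (prep (block v) (blocks-reflect vs)) ,
    length-reflect vs
  rotate {σ} {v} {vs} s c (there s∈) with ∈-map⁻ block s∈
  ... | x , x∈ , e with ∈-∃++ x∈
  ...   | xs , ys , refl with walk-split xs c
  ...     | p , q with rotate {σ} {x} {ys ++ v ∷ xs} s (walk-++ ys q p) (here e)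
  ...       | vs′ , c′ , b , l = vs′ , c′ , ↭-trans b perm , ≡-trans l len
    where
    perm : map block (x ∷ ys ++ v ∷ xs) ↭ map block (v ∷ xs ++ x ∷ ys)
    perm = map-↭ block (++-comm (x ∷ ys) (v ∷ xs))
    len : length (ys ++ v ∷ xs) ≡ length (xs ++ x ∷ ys)
    len = cong pred (↭-length (++-comm (x ∷ ys) (v ∷ xs)))

  toFront : ∀ {σ D} s → All (IsCycle σ) D → block s ∈ blocks D →
    ∃₂ λ vs D′ → All (IsCycle σ) ((s , vs) ∷ D′) ×
      blocks ((s , vs) ∷ D′) ↭ blocks D × sizes ((s , vs) ∷ D′) ↭ sizes D
  toFront {σ} {(v , vs) ∷ D} s (c ∷ cs) s∈ with ∈-++⁻ (map block (v ∷ vs)) s∈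
  ... | inj₁ s∈c with vs′ , c′ , b , l ← rotate {σ} {v} {vs} s c s∈c =
    vs′ , D , c′ ∷ cs , ++⁺ʳ (blocks D) b , ↭-reflexive (cong (_∷ sizes D) l)
  ... | inj₂ s∈D with vs′ , D′ , c′ ∷ cs′ , b , l ← toFront s cs s∈D =
    vs′ , (v , vs) ∷ D′ , c′ ∷ c ∷ cs′ ,
    ↭-trans (shifts (map block (s ∷ vs′)) (map block (v ∷ vs))) (++⁺ˡ (map block (v ∷ vs)) b) ,
    ↭-trans (swap (length vs′) (length vs) ↭-refl) (prep (length vs) l)

  -- The product of (s t) with `σ`. The transposition enters through its inverse because the
  -- coefficient of `σ` in (s t) y is that of (s t)⁻¹ σ in y. On dashed edges it exchanges the end
  -- points `s` and `t`.
  swapped : Permutation′ (n * 2) → Point n → Point n → Permutation′ (n * 2)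
  swapped σ s t = σ ∘ₚ flip (transpose s t)

  module _ (σ : Permutation′ (n * 2)) (s t : Point n) where
    private
      τ : Point n → Point n
      τ = transpose s t ⟨$⟩ʳ_

      Avoids : Fin n → Set
      Avoids j = j ≢ block s × j ≢ block t

      fixed : ∀ {x} → Avoids (block x) → τ x ≡ x
      fixed (≢s , ≢t) = transpose-other s t (≢s ∘ cong block) (≢t ∘ cong block)

      fixed-bar : ∀ {x} → Avoids (block x) → τ (bar n x) ≡ bar n x
      fixed-bar {x} a = fixed (subst Avoids (sym (block-bar x)) a)

    -- τ maps the dashed edges of swapped σ s t to those of σ.
    walk-swapped : ∀ {v v′ w w′ xs} → τ (bar n v′) ≡ bar n v → τ w′ ≡ w →
      All Avoids (map block xs) → Walk σ v xs w → Walk (swapped σ s t) v′ xs w′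
    walk-swapped ev ew [] [ d ] =
      [ ≡-trans (cong (σ ⟨$⟩ˡ_) ew) (≡-trans d (cong (λ z → bar n (σ ⟨$⟩ˡ z)) (sym ev))) ]
    walk-swapped ev ew (a ∷ as) (d ∷ p) =
      ≡-trans (cong (σ ⟨$⟩ˡ_) (fixed a)) (≡-trans d (cong (λ z → bar n (σ ⟨$⟩ˡ z)) (sym ev))) ∷
      walk-swapped (fixed-bar a) ew as p

    dash-swapped : ∀ {x y} → Avoids (block x) → Avoids (block y) →
      Dash σ x y → Dash (swapped σ s t) x y
    dash-swapped a b d =
      ≡-trans (cong (σ ⟨$⟩ˡ_) (fixed b)) (≡-trans d (cong (λ z → bar n (σ ⟨$⟩ˡ z)) (sym (fixed a))))

    dash-swapped⁻ : ∀ {x y} → Avoids (block x) → Avoids (block y) →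
      Dash (swapped σ s t) x y → Dash σ x y
    dash-swapped⁻ a b d =
      ≡-trans (cong (σ ⟨$⟩ˡ_) (sym (fixed b))) (≡-trans d (cong (λ z → bar n (σ ⟨$⟩ˡ z)) (fixed a)))

    cycles-swapped : ∀ {D} → All Avoids (blocks D) → All (IsCycle σ) D → All (IsCycle (swapped σ s t)) D
    cycles-swapped {[]}           _        []       = []
    cycles-swapped {(v , vs) ∷ D} (a ∷ as) (c ∷ cs) =
      walk-swapped (fixed-bar a) (fixed a) (Allₚ.++⁻ˡ (map block vs) as) c ∷
      cycles-swapped (Allₚ.++⁻ʳ (map block vs) as) cs

    module _ (s≢t : block s ≢ block t) where
      private
        bar-s : τ (bar n s) ≡ bar n s
        bar-s = transpose-other s t (bar≢ s) (λ e → s≢t (≡-trans (sym (block-bar s)) (cong block e)))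

        bar-t : τ (bar n t) ≡ bar n t
        bar-t = transpose-other s t (λ e → s≢t (sym (≡-trans (sym (block-bar t)) (cong block e)))) (bar≢ t)

      -- The cycle arrives at both `s` and `t` along dashed edges. Exchanging these two ends closes
      -- each of the two stretches between them on itself.
      split-swapped : ∀ {xs ys} → All Avoids (map block xs) → All Avoids (map block ys) →
        Walk σ t (xs ++ s ∷ ys) t →
        Walk (swapped σ s t) t xs t × Walk (swapped σ s t) s ys s
      split-swapped {xs} a b c with p , q ← walk-split xs c =
        walk-swapped bar-t (transpose-right s t) a p , walk-swapped bar-s (transpose-left s t) b q

      merge-swapped : ∀ {xs ys} → All Avoids (map block xs) → All Avoids (map block ys) →
        Walk σ t xs t → Walk σ s ys s → Walk (swapped σ s t) t (xs ++ s ∷ ys) t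
      merge-swapped {xs} a b p q =
        walk-++ xs (walk-swapped bar-t (transpose-left s t) a p)
                   (walk-swapped bar-s (transpose-right s t) b q)

      -- Here the cycle arrives at `bar n s`, so it leaves `s`, and arrives at `t`, along dashed
      -- edges. Exchanging the ends `s` and `t` makes the stretch between them run backwards, and
      -- the cycle stays in one piece.
      twist-swapped : ∀ {xs ys} → All Avoids (map block xs) → All Avoids (map block ys) →
        Walk σ t (xs ++ bar n s ∷ ys) t → Walk (swapped σ s t) t (xs ++ bar n s ∷ reflect ys) t
      twist-swapped {xs} {ys} a b c with p , q ← walk-split xs c =
        walk-++ xs (walk-swapped bar-t bar-s a p)
          (walk-swapped (≡-trans (cong τ (bar-involutive s))
                          (≡-trans (transpose-left s t) (sym (bar-involutive t))))
            (transpose-right s t) (All-resp-↭ (↭-sym (blocks-reflect ys)) b)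
            (subst (Walk σ (bar n t) (reflect ys)) (bar-involutive s) (walk-reflect ys q)))

  -- The blocks from `m` on belong to variables already given up, and their dashed edges must be
  -- solid for anything to be counted. As `below` has no repetitions, `cover` says both that the
  -- cycles exhaust the other blocks and that they share none.
  record Decomposition (m : ℕ) .(m≤n : m ≤ n) (σ : Permutation′ (n * 2)) (D : List Cycle) : Set where
    constructor mkDecomposition
    field
      cycles  : All (IsCycle σ) D
      cover   : blocks D ↭ below m m≤n
      outside : ∀ j → m ≤ toℕ j → Dash σ (plain n j) (barred n j)

  open Decomposition

  avoid : ∀ s t {L} → Unique (block s ∷ block t ∷ L) →
    block s ≢ block t × All (λ j → j ≢ block s × j ≢ block t) L
  avoid s t ((s≢t ∷ s≢) ∷ t≢ ∷ _) =
    s≢t , All.zipWith (λ { (p , q) → (p ∘ sym) , (q ∘ sym) }) (s≢ , t≢)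

  blocks-two : ∀ t xs s ys D → blocks ((t , xs) ∷ (s , ys) ∷ D) ↭
    block s ∷ block t ∷ map block xs ++ map block ys ++ blocks D
  blocks-two t xs s ys D = shift (block s) (block t ∷ map block xs) (map block ys ++ blocks D)

  blocks-join : ∀ t xs s ys D →
    blocks ((t , xs ++ s ∷ ys) ∷ D) ≡ blocks ((t , xs) ∷ (s , ys) ∷ D)
  blocks-join t xs s ys D = cong (block t ∷_)
    (≡-trans (cong (_++ blocks D) (map-++ block xs (s ∷ ys)))
             (++-assoc (map block xs) (map block (s ∷ ys)) (blocks D)))

  module _ {m : ℕ} .(m≤n : m ≤ n) where

    unique-blocks : ∀ {D} → blocks D ↭ below m m≤n → Unique (blocks D)
    unique-blocks b = unique-↭ (↭-sym b) (unique-below m m≤n)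

    module _ {σ : Permutation′ (n * 2)} where

      outside-swapped : ∀ s t → toℕ (block s) < m → toℕ (block t) < m →
        (∀ j → m ≤ toℕ j → Dash σ (plain n j) (barred n j)) →
        ∀ j → m ≤ toℕ j → Dash (swapped σ s t) (plain n j) (barred n j)
      outside-swapped s t s<m t<m o j m≤j = dash-swapped σ s t
        (avoids (block-plain j)) (avoids (block-barred j)) (o j m≤j)
        where
        avoids : ∀ {i} → i ≡ j → i ≢ block s × i ≢ block t
        avoids refl = (λ { refl → <⇒≱ s<m m≤j }) , (λ { refl → <⇒≱ t<m m≤j })

      module Joint {t xs s ys D} (b : blocks ((t , xs) ∷ (s , ys) ∷ D) ↭ below m m≤n) where

        perm : block s ∷ block t ∷ map block xs ++ map block ys ++ blocks D ↭ below m m≤n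
        perm = ↭-trans (↭-sym (blocks-two t xs s ys D)) b

        s<m : toℕ (block s) < m
        s<m = ∈-below⁻ m m≤n (∈-resp-↭ perm (here refl))

        t<m : toℕ (block t) < m
        t<m = ∈-below⁻ m m≤n (∈-resp-↭ perm (there (here refl)))

        private
          avoided = avoid s t (unique-↭ (↭-sym perm) (unique-below m m≤n))
          rest    = Allₚ.++⁻ʳ (map block xs) (proj₂ avoided)

        s≢t : block s ≢ block t
        s≢t = proj₁ avoided

        avoid-xs : All (λ j → j ≢ block s × j ≢ block t) (map block xs)
        avoid-xs = Allₚ.++⁻ˡ (map block xs) (proj₂ avoided)

        avoid-ys : All (λ j → j ≢ block s × j ≢ block t) (map block ys)
        avoid-ys = Allₚ.++⁻ˡ (map block ys) rest

        avoid-D : All (λ j → j ≢ block s × j ≢ block t) (blocks D)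
        avoid-D = Allₚ.++⁻ʳ (map block ys) rest

      split : ∀ {t xs s ys D} → Decomposition m m≤n σ ((t , xs ++ s ∷ ys) ∷ D) →
        Decomposition m m≤n (swapped σ s t) ((t , xs) ∷ (s , ys) ∷ D)
      split {t} {xs} {s} {ys} {D} (mkDecomposition (c ∷ cs) b o) =
        mkDecomposition (proj₁ pq ∷ proj₂ pq ∷ cycles-swapped σ s t T.avoid-D cs) b′
          (outside-swapped s t T.s<m T.t<m o)
        where
        b′ = ↭-trans (↭-reflexive (sym (blocks-join t xs s ys D))) b
        module T = Joint {t} {xs} {s} {ys} {D} b′
        pq = split-swapped σ s t T.s≢t T.avoid-xs T.avoid-ys c

      merge : ∀ {t xs s ys D} → Decomposition m m≤n σ ((t , xs) ∷ (s , ys) ∷ D) →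
        Decomposition m m≤n (swapped σ s t) ((t , xs ++ s ∷ ys) ∷ D)
      merge {t} {xs} {s} {ys} {D} (mkDecomposition (c ∷ c′ ∷ cs) b o) =
        mkDecomposition
          (merge-swapped σ s t T.s≢t T.avoid-xs T.avoid-ys c c′ ∷ cycles-swapped σ s t T.avoid-D cs)
          (↭-trans (↭-reflexive (blocks-join t xs s ys D)) b)
          (outside-swapped s t T.s<m T.t<m o)
        where module T = Joint {t} {xs} {s} {ys} {D} b

      twist : ∀ {t xs v ys D} → Decomposition m m≤n σ ((t , xs ++ v ∷ ys) ∷ D) →
        Decomposition m m≤n (swapped σ (bar n v) t) ((t , xs ++ v ∷ reflect ys) ∷ D)
      twist {t} {xs} {v} {ys} {D} (mkDecomposition (c ∷ cs) b o) =
        mkDecomposition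
          (subst (λ x → Walk (swapped σ s t) t (xs ++ x ∷ reflect ys) t) (bar-involutive v)
             (twist-swapped σ s t T.s≢t T.avoid-xs T.avoid-ys
               (subst (λ x → Walk σ t (xs ++ x ∷ ys) t) (sym (bar-involutive v)) c)) ∷
           cycles-swapped σ s t T.avoid-D cs)
          (↭-trans (++⁺ʳ (blocks D) (prep (block t)
            (↭-trans (blocks-insert xs v (reflect ys))
              (↭-trans (prep (block v) (++⁺ˡ (map block xs) (blocks-reflect ys)))
                (↭-sym (blocks-insert xs v ys)))))) b)
          (outside-swapped s t T.s<m T.t<m o)
        where
        s = bar n v
        b′ : blocks ((t , xs) ∷ (s , ys) ∷ D) ↭ below m m≤n
        b′ = ↭-trans (↭-reflexive (≡-trans
               (cong (λ j → block t ∷ map block xs ++ j ∷ map block ys ++ blocks D) (block-bar v))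
               (sym (blocks-join t xs v ys D)))) b
        module T = Joint {t} {xs} {s} {ys} {D} b′

      bringToFront : ∀ {D} s → Decomposition m m≤n σ D → toℕ (block s) < m →
        ∃₂ λ vs D′ → Decomposition m m≤n σ ((s , vs) ∷ D′) × sizes ((s , vs) ∷ D′) ↭ sizes D
      bringToFront s (mkDecomposition cs b o) s<m
        with toFront s cs (∈-resp-↭ (↭-sym b) (∈-below⁺ m m≤n s<m))
      ... | vs , D′ , cs′ , b′ , l = vs , D′ , mkDecomposition cs′ (↭-trans b′ b) o , l

  -- `H_n` is the stabilizer of the solid matching, so membership in it means that dashed and solid
  -- edges coincide, or that every cycle has a single solid edge.
  hyperoctahedral⇒dash : ∀ {σ} → Hyperoctahedral n σ → ∀ x → Dash σ x (bar n x)
  hyperoctahedral⇒dash {σ} hyp x =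
    ≡-trans (cong (λ y → σ ⟨$⟩ˡ bar n y) (sym (inverseʳ σ)))
      (≡-trans (cong (σ ⟨$⟩ˡ_) (hyp (σ ⟨$⟩ˡ x))) (inverseˡ σ))

  dash⇒hyperoctahedral : ∀ {σ} → (∀ x → Dash σ x (bar n x)) → Hyperoctahedral n σ
  dash⇒hyperoctahedral {σ} d v =
    ≡-trans (sym (inverseʳ σ))
      (cong (σ ⟨$⟩ʳ_) (≡-trans (d (σ ⟨$⟩ʳ v)) (cong (bar n) (inverseˡ σ))))

  -- The coefficient of σ in h k (J i₁, J i₂, …) p for L = i₁, i₂, … .
  F : ℕ → List (Fin n) → Permutation′ (n * 2) → ℕ
  F zero    L       σ = if does (hyperoctahedral? n σ) then 1 else 0
  F (suc k) []      σ = 0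
  F (suc k) (i ∷ L) σ =
    sum (map (λ s → F k (i ∷ L) (swapped σ s (plain n i))) (earlier i)) + F (suc k) L σ

  -- The transpositions still available move only points in blocks below `m`. So `plain n j` and
  -- `barred n j` never become joined by a dashed edge, and no hyperoctahedral permutation is
  -- reached.
  F-outside : ∀ k m .(m≤n : m ≤ n) σ j → m ≤ toℕ j → ¬ Dash σ (plain n j) (barred n j) →
    F k (below m m≤n) σ ≡ 0
  F-outside zero m m≤n σ j _ ¬d
    rewrite dec-false (hyperoctahedral? n σ)
      (λ hyp → ¬d (subst (Dash σ (plain n j)) (bar-plain j) (hyperoctahedral⇒dash {σ} hyp (plain n j)))) = refl
  F-outside (suc k) zero m≤n σ j _ ¬d = refl
  F-outside (suc k) (suc m) m<n σ j m<j ¬d = cong₂ _+_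
    (sum-zero _ (earlier i) λ s s∈ →
      let s<i = <-plain⁻ (proj₂ (∈-filter⁻ (Finₚ._<? plain n i) {xs = allFin (n * 2)} s∈))
          s<m = subst (toℕ (block s) <_) (Finₚ.toℕ-fromℕ< m<n) s<i
          avoids : ∀ {x} → block x ≡ j → block x ≢ block s × block x ≢ block t
          avoids x≡j =
            (λ e → <⇒≢ (<-trans s<m m<j) (cong toℕ (≡-trans (sym e) x≡j))) ,
            (λ e → <⇒≢ m<j (≡-trans (sym (Finₚ.toℕ-fromℕ< m<n))
              (cong toℕ (≡-trans (sym (block-plain i)) (≡-trans (sym e) x≡j)))))
      in F-outside k (suc m) m<n (swapped σ s t) j m<j λ d →
           ¬d (dash-swapped⁻ σ s t (avoids (block-plain j)) (avoids (block-barred j)) d))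
    (F-outside (suc k) m (<⇒≤ m<n) σ j (<⇒≤ m<j) ¬d)
    where
    i = fromℕ< m<n
    t = plain n i

  hyperoctahedral⇒sizes : ∀ {σ} D → All (IsCycle σ) D → Unique (blocks D) →
    Hyperoctahedral n σ → sum (sizes D) ≡ 0
  hyperoctahedral⇒sizes []                   _              _             _   = refl
  hyperoctahedral⇒sizes ((v , [])     ∷ D)   (_ ∷ cs)       (_ ∷ u)       hyp =
    hyperoctahedral⇒sizes D cs u hyp
  hyperoctahedral⇒sizes {σ} ((v , x ∷ xs) ∷ D) ((d ∷ _) ∷ _) ((v≢x ∷ _) ∷ _) hyp =
    contradiction (cong block (dash-unique σ (dash-sym σ (hyperoctahedral⇒dash {σ} hyp v)) d)) v≢x

  sizes⇒hyperoctahedral : ∀ {m} .{m≤n : m ≤ n} {σ D} → Decomposition m m≤n σ D →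
    sum (sizes D) ≡ 0 → Hyperoctahedral n σ
  sizes⇒hyperoctahedral {m} {m≤n} {σ} {D} dec z = dash⇒hyperoctahedral {σ} dash
    where
    dash : ∀ x → Dash σ x (bar n x)
    dash x with m ≤? toℕ (block x)
    ... | yes m≤x with plain-or-barred x
    ...   | inj₁ e = subst (λ y → Dash σ y (bar n y)) (sym e)
              (subst (Dash σ (plain n (block x))) (sym (bar-plain _)) (outside dec (block x) m≤x))
    ...   | inj₂ e = subst (λ y → Dash σ y (bar n y)) (sym e)
              (subst (Dash σ (barred n (block x))) (sym (bar-barred _))
                (dash-sym σ (outside dec (block x) m≤x)))
    dash x | no m≰x with bringToFront m≤n x dec (≰⇒> m≰x)
    ... | [] , D′ , mkDecomposition ([ d ] ∷ _) _ _ , l = dash-sym σ d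
    ... | _ ∷ _ , D′ , _ , l with () ← ≡-trans (sum-↭ l) z

  -- Induction on `k`, then on `m`: a transposition lowers `k`, giving up the largest variable
  -- lowers `m`. Truncated subtraction collects all degrees below the threshold in the value 0,
  -- where `val` vanishes. The hypothesis passes to every permutation reached, since no
  -- transposition used here increases the difference.
  F-val : ∀ k m .(m≤n : m ≤ n) σ D → Decomposition m m≤n σ D → suc k ∸ sum (sizes D) ≤ 2 →
    2 * F k (below m m≤n) σ ≡ val (suc k ∸ sum (sizes D)) (sizes D)

  -- t is the largest point that is not barred, and its cycle has been rotated to
  -- start with t.  An earlier point s = v or s = bar v either lies on the same
  -- cycle t ∷ xs ++ v ∷ ys, which (s t) splits at s = v and merely reorders at
  -- s = bar v, or on another one; then (s t) merges the two cycles, and the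
  -- degree is too small for the result.
  F-val-front : ∀ k m .(m<n : suc m ≤ n) σ vs D →
    Decomposition (suc m) m<n σ ((plain n (fromℕ< m<n) , vs) ∷ D) →
    suc (suc k) ∸ (length vs + sum (sizes D)) ≤ 2 →
    2 * F (suc k) (below (suc m) m<n) σ ≡
    val (suc (suc k) ∸ (length vs + sum (sizes D))) (length vs ∷ sizes D)

  F-val zero m m≤n σ D dec _ with sum (sizes D) in eq
  ... | zero
    rewrite dec-true (hyperoctahedral? n σ) (sizes⇒hyperoctahedral {m} {m≤n} {σ} {D} dec eq) =
      cong (2 *_) (sym (catalans-trivial (sizes D) eq))
  ... | suc z
    rewrite dec-false (hyperoctahedral? n σ)
              (λ hyp → 1+n≢0 (≡-trans (sym eq) (hyperoctahedral⇒sizes D (cycles dec)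
                (unique-blocks m≤n {D} (cover dec)) hyp)))
          | 0∸n≡0 z = refl
  -- No variable is left in positive degree, so the coefficient is 0. Degree 1 agrees with
  -- `val 2 []`, which is 0, and higher degrees exceed the bound.
  F-val (suc k) zero m≤n σ [] dec ok with k
  ... | zero = refl
  ... | suc _ with s≤s (s≤s ()) ← ok
  F-val (suc k) zero m≤n σ (_ ∷ _) dec ok with () ← ↭-length (cover dec)
  F-val (suc k) (suc m) m<n σ D dec ok
    with bringToFront m<n (plain n (fromℕ< m<n)) dec
           (subst (_< suc m) (sym (≡-trans (cong toℕ (block-plain (fromℕ< m<n))) (Finₚ.toℕ-fromℕ< m<n))) ≤-refl)
  ... | vs , D′ , dec′ , l =
    ≡-trans (F-val-front k m m<n σ vs D′ dec′ (subst (λ z → suc (suc k) ∸ z ≤ 2) (sym (sum-↭ l)) ok))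
      (≡-trans (cong (λ z → val (suc (suc k) ∸ z) (length vs ∷ sizes D′)) (sum-↭ l))
               (val-↭ (suc (suc k) ∸ sum (sizes D)) l))

  F-val-front k m m<n σ vs D dec ok = begin
    2 * (sum (map g (earlier i)) + F (suc k) (below m (<⇒≤ m<n)) σ)
      ≡⟨ *-distribˡ-+ 2 (sum (map g (earlier i))) _ ⟩
    2 * sum (map g (earlier i)) + 2 * F (suc k) (below m (<⇒≤ m<n)) σ
      ≡⟨ cong (λ z → 2 * z + 2 * F (suc k) (below m (<⇒≤ m<n)) σ) (begin
        sum (map g (earlier i))
          ≡⟨ sum-earlier m m<n g ⟩
        sum (map (pairs g) (below m (<⇒≤ m<n)))
          ≡⟨ sum-↭ (map-↭ (pairs g) (↭-sym rest)) ⟩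
        sum (map (pairs g) (map block vs ++ blocks D))
          ≡⟨ cong sum (map-++ (pairs g) (map block vs) (blocks D)) ⟩
        sum (map (pairs g) (map block vs) ++ map (pairs g) (blocks D))
          ≡⟨ sum-++ (map (pairs g) (map block vs)) _ ⟩
        sum (map (pairs g) (map block vs)) + sum (map (pairs g) (blocks D))
          ≡⟨ cong₂ _+_ (sum-pairs-points g vs) (sum-zero (pairs g) (blocks D) λ j j∈ →
               cong₂ _+_ (merged (plain n j) (subst (_∈ blocks D) (sym (block-plain j)) j∈))
                         (merged (barred n j) (subst (_∈ blocks D) (sym (block-barred j)) j∈))) ⟩
        sum (map (λ v → g v + g (bar n v)) vs) + 0
          ≡⟨ +-identityʳ _ ⟩
        sum (map (λ v → g v + g (bar n v)) vs) ∎) ⟩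
    2 * sum (map (λ v → g v + g (bar n v)) vs) + 2 * F (suc k) (below m (<⇒≤ m<n)) σ
      ≡⟨ cong (_+ 2 * F (suc k) (below m (<⇒≤ m<n)) σ) (begin
        2 * sum (map (λ v → g v + g (bar n v)) vs)
          ≡⟨ sum-double (λ v → g v + g (bar n v)) vs ⟩
        sum (map (λ v → 2 * (g v + g (bar n v))) vs)
          ≡⟨ sum-splits _ (λ a b → val c (a ∷ b ∷ I) + val (pred c) (length vs ∷ I)) vs same ⟩
        splits (λ a b → val c (a ∷ b ∷ I) + val (pred c) (length vs ∷ I)) (length vs)
          ≡⟨ splits-+ (λ a b → val c (a ∷ b ∷ I)) (λ _ _ → val (pred c) (length vs ∷ I)) (length vs) ⟩
        splits (λ a b → val c (a ∷ b ∷ I)) (length vs) +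
        splits (λ _ _ → val (pred c) (length vs ∷ I)) (length vs)
          ≡⟨ cong (splits (λ a b → val c (a ∷ b ∷ I)) (length vs) +_)
               (splits-constant (val (pred c) (length vs ∷ I)) (length vs)) ⟩
        splits (λ a b → val c (a ∷ b ∷ I)) (length vs) +
        length vs * val (pred c) (length vs ∷ I) ∎) ⟩
    splits (λ a b → val c (a ∷ b ∷ I)) (length vs) +
    length vs * val (pred c) (length vs ∷ I) + 2 * F (suc k) (below m (<⇒≤ m<n)) σ
      ≡⟨ last vs dec ok ⟩
    val c (length vs ∷ I) ∎
    where
    open ≡-Reasoning
    i = fromℕ< m<n
    t = plain n i
    L = below (suc m) m<n
    I = sizes D
    c = suc (suc k) ∸ (length vs + sum I)

    g : Point n → ℕ
    g s = F k L (swapped σ s t)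

    rest : map block vs ++ blocks D ↭ below m (<⇒≤ m<n)
    rest = drop-∷ (subst (λ j → j ∷ map block vs ++ blocks D ↭ L) (block-plain i) (cover dec))

    merged : ∀ s → block s ∈ blocks D → g s ≡ 0
    merged s s∈ with toFront s (All.tail (cycles dec)) s∈
    ... | ys , D′ , cs′ , b′ , l = m*n≡0⇒m≡0 (g s) 2 (≡-trans (*-comm (g s) 2) (begin
      2 * F k L (swapped σ s t)
        ≡⟨ F-val k (suc m) m<n (swapped σ s t) _
             (merge m<n (mkDecomposition (All.head (cycles dec) ∷ cs′)
               (↭-trans (++⁺ˡ (map block (t ∷ vs)) b′) (cover dec)) (outside dec)))
             (subst (_≤ 2) (sym degree) z≤n) ⟩
      val (suc k ∸ (length (vs ++ s ∷ ys) + sum (sizes D′))) _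
        ≡⟨ cong (λ z → val z (length (vs ++ s ∷ ys) ∷ sizes D′)) degree ⟩
      0 ∎))
      where
      S = length vs + sum I
      degree : suc k ∸ (length (vs ++ s ∷ ys) + sum (sizes D′)) ≡ 0
      degree = ≡-trans
        (cong (suc k ∸_) (begin
          length (vs ++ s ∷ ys) + sum (sizes D′)
            ≡⟨ cong (_+ sum (sizes D′)) (length-++ vs) ⟩
          length vs + suc (length ys) + sum (sizes D′)
            ≡⟨ lemma (length vs) (length ys) (sum (sizes D′)) ⟩
          suc (length vs + (length ys + sum (sizes D′)))
            ≡⟨ cong (λ z → suc (length vs + z)) (sum-↭ l) ⟩
          suc S ∎))
        -- From `ok`, `suc (suc k)` is at most `S + 2`, hence `k ≤ S`: one degree is spent, and one
        -- entry is gained by the merging.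
        (m≤n⇒m∸n≡0 (s≤s⁻¹ (s≤s⁻¹ (subst (suc (suc k) ≤_) (+-comm S 2)
          (≤-trans (m≤n+m∸n (suc (suc k)) S) (+-monoʳ-≤ S ok))))))
        where
        lemma : ∀ x y z → x + suc y + z ≡ suc (x + (y + z))
        lemma = solve-∀

    same : ∀ xs v ys → vs ≡ xs ++ v ∷ ys →
      2 * (g v + g (bar n v)) ≡
      val c (length xs ∷ length ys ∷ I) + val (pred c) (length vs ∷ I)
    same xs v ys refl = ≡-trans (*-distribˡ-+ 2 (g v) (g (bar n v))) (cong₂ _+_
      (≡-trans
        (F-val k (suc m) m<n (swapped σ v t) _ (split m<n dec) (subst (_≤ 2) (sym degree) ok))
        (cong (λ z → val z (length xs ∷ length ys ∷ I)) degree))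
      (≡-trans
        (F-val k (suc m) m<n (swapped σ (bar n v) t) _ (twist m<n dec)
          (subst (_≤ 2) (sym degree′) (≤-trans (pred[n]≤n {c}) ok)))
        (cong₂ (λ z w → val z (w ∷ I)) degree′ len)))
      where
      len : length (xs ++ v ∷ reflect ys) ≡ length (xs ++ v ∷ ys)
      len = ≡-trans (length-++ xs)
        (≡-trans (cong (λ z → length xs + suc z) (length-reflect ys)) (sym (length-++ xs)))
      degree : suc k ∸ (length xs + (length ys + sum I)) ≡ c
      degree = cong (suc (suc k) ∸_) (sym (≡-trans (cong (_+ sum I) (length-++ xs))
        (lemma (length xs) (length ys) (sum I))))
        where
        lemma : ∀ x y z → x + suc y + z ≡ suc (x + (y + z))
        lemma = solve-∀
      degree′ : suc k ∸ (length (xs ++ v ∷ reflect ys) + sum I) ≡ pred c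
      degree′ = ≡-trans (cong (λ z → suc k ∸ (z + sum I)) len)
        (sym (pred[m∸n]≡m∸[1+n] (suc (suc k)) (length (xs ++ v ∷ ys) + sum I)))

    last : ∀ vs → Decomposition (suc m) m<n σ ((t , vs) ∷ D) →
      (let c = suc (suc k) ∸ (length vs + sum I)) → c ≤ 2 →
      splits (λ a b → val c (a ∷ b ∷ I)) (length vs) + length vs * val (pred c) (length vs ∷ I) +
      2 * F (suc k) (below m (<⇒≤ m<n)) σ ≡ val c (length vs ∷ I)
    -- The largest block is a cycle by itself, so its dashed edge is solid and it joins the blocks
    -- outside the decomposition.
    last [] (mkDecomposition ([ d ] ∷ cs) b o) ok =
      ≡-trans
        (F-val (suc k) m (<⇒≤ m<n) σ D
          (mkDecomposition cs (drop-∷ (subst (λ j → j ∷ blocks D ↭ L) (block-plain i) b)) o′) ok)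
        (sym (val-zero (suc (suc k) ∸ sum I) I))
      where
      o′ : ∀ j → m ≤ toℕ j → Dash σ (plain n j) (barred n j)
      o′ j m≤j with m≤n⇒m<n∨m≡n m≤j
      ... | inj₁ m<j = o j m<j
      ... | inj₂ m≡j with refl ← Finₚ.toℕ-injective {i = i} {j} (≡-trans (Finₚ.toℕ-fromℕ< m<n) m≡j) =
        dash-sym σ (subst (λ x → Dash σ x t) (bar-plain i) d)
    -- Without the variable of the largest index, the dashed edge from `bar n t` to `x` in another
    -- block can no longer be changed into a solid one.
    last (x ∷ xs) (mkDecomposition ((d ∷ _) ∷ _) b _) ok =
      ≡-trans (cong (λ z → main + 2 * z)
                (F-outside (suc k) m (<⇒≤ m<n) σ i (≤-reflexive (sym (Finₚ.toℕ-fromℕ< m<n))) λ d′ →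
                  t≢x (cong block
                    (dash-unique σ (subst (λ y → Dash σ y t) (sym (bar-plain i)) (dash-sym σ d′)) d))))
        (≡-trans (+-identityʳ _) (sym (val-suc c₁ (length xs) I ok)))
      where
      c₁ = suc (suc k) ∸ (length (x ∷ xs) + sum I)
      main = splits (λ a b → val c₁ (a ∷ b ∷ I)) (length (x ∷ xs)) +
             length (x ∷ xs) * val (pred c₁) (length (x ∷ xs) ∷ I)
      t≢x : block t ≢ block x
      t≢x with (t≢x ∷ _) ∷ _ ← unique-blocks m<n {(t , x ∷ xs) ∷ D} b = t≢x

-- Coset types

module CosetTypes (n : ℕ) where
  open Points n
  open Matchings n
  open Decomposition

  -- Cycles are grown one solid edge at a time by merging the cycle of length 2
  -- on a new pair of points.
  realize : ∀ m .(m≤n : m ≤ n) I → sum I + length I ≡ m →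
    ∃₂ λ σ D → Decomposition m m≤n σ D × sizes D ≡ I
  realize-suc : ∀ m .(m<n : suc m ≤ n) I → sum I + length I ≡ m →
    ∃₂ λ σ D → Decomposition (suc m) m<n σ ((plain n (fromℕ< m<n) , []) ∷ D) × sizes D ≡ I

  realize zero    m≤n []            e = idₚ , [] , mkDecomposition [] ↭-refl (λ j _ → sym (bar-plain j)) , refl
  realize zero    m≤n (q ∷ I)       e = contradiction (≡-trans (sym (+-suc (q + sum I) (length I))) e) 1+n≢0
  realize (suc m) m<n (zero ∷ I)    e
    with realize-suc m m<n I (suc-injective (≡-trans (sym (+-suc (sum I) (length I))) e))
  ... | σ , D , dec , eq = σ , _ , dec , cong (0 ∷_) eq
  realize (suc m) m<n (suc q ∷ I)   e with realize-suc m m<n (q ∷ I) (suc-injective e)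
  ... | σ , (s , ys) ∷ D , dec , refl = _ , _ , merge m<n dec , refl

  realize-suc m m<n I e with realize m (<⇒≤ m<n) I e
  ... | σ , D , mkDecomposition cs b o , eq = σ , D , mkDecomposition
    ([ dash-sym σ (subst (Dash σ t) (sym (bar-plain i)) (o i (≤-reflexive (sym (Finₚ.toℕ-fromℕ< m<n))))) ] ∷ cs)
    (↭-trans (↭-reflexive (cong (_∷ blocks D) (block-plain i))) (prep i b))
    (λ j m<j → o j (<⇒≤ m<j)) , eq
    where
    i = fromℕ< m<n
    t = plain n i

  On : Cycle → Point n → Set
  On (v , vs) x = block x ∈ map block (v ∷ vs)

  module _ (σ : Permutation′ (n * 2)) where

    solid-connected : ∀ v → Connected n σ v (bar n v)
    solid-connected v with plain-or-barred v
    ... | inj₁ e = fwd (inj₁ (block v , e , ≡-trans (cong (bar n) e) (bar-plain _))) ◅ ε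
    ... | inj₂ e = bwd (inj₁ (block v , ≡-trans (cong (bar n) e) (bar-barred _) , e)) ◅ ε

    dash-connected : ∀ {x y} → Dash σ x y → Connected n σ x y
    dash-connected {x} {y} d with plain-or-barred (σ ⟨$⟩ˡ x)
    ... | inj₁ e = fwd (inj₂ (_ , image e , image (≡-trans d (≡-trans (cong (bar n) e) (bar-plain _))))) ◅ ε
      where
      image : ∀ {x z} → σ ⟨$⟩ˡ x ≡ z → x ≡ σ ⟨$⟩ʳ z
      image refl = sym (inverseʳ σ)
    ... | inj₂ e = bwd (inj₂ (_ , image (≡-trans d (≡-trans (cong (bar n) e) (bar-barred _))) , image e)) ◅ ε
      where
      image : ∀ {x z} → σ ⟨$⟩ˡ x ≡ z → x ≡ σ ⟨$⟩ʳ z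
      image refl = sym (inverseʳ σ)

    dashedEdge⇒dash : ∀ {x y} → DashedEdge n σ x y → Dash σ x y
    dashedEdge⇒dash (i , refl , refl) =
      ≡-trans (inverseˡ σ) (≡-trans (sym (bar-plain i)) (cong (bar n) (sym (inverseˡ σ))))

    walk-connected : ∀ {x y w xs} → Walk σ x xs w → block y ∈ map block (x ∷ xs) → Connected n σ x y
    walk-connected {x} {y} p (here e) with same-block {x} {y} e
    ... | inj₁ refl = ε
    ... | inj₂ refl = solid-connected x
    walk-connected {x} (d ∷ p) (there y∈) = solid-connected x ◅◅ dash-connected d ◅◅ walk-connected p y∈

    module _ {c : Cycle} (isCycle : IsCycle σ c) where

      cycle-connected : ∀ {x y} → On c x → On c y → Connected n σ x y
      cycle-connected {x} x∈ y∈ with rotate x isCycle x∈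
      ... | vs , isCycle′ , b , _ = walk-connected isCycle′ (∈-resp-↭ (↭-sym b) y∈)

      -- When the cycle is started at `bar n x`, its first dashed edge leaves from `x`, and there is
      -- only one dashed edge at `x`.
      dash-closed : ∀ {x y} → On c x → Dash σ x y → On c y
      dash-closed {x} {y} x∈ d
        with rotate (bar n x) isCycle (subst (_∈ map block (proj₁ c ∷ proj₂ c)) (sym (block-bar x)) x∈)
      ... | [] , [ d′ ] , b , _ = ∈-resp-↭ b (here (cong block
        (dash-unique σ d (subst (λ z → Dash σ z (bar n x)) (bar-involutive x) d′))))
      ... | z ∷ _ , d′ ∷ _ , b , _ = ∈-resp-↭ b (there (here (cong block
        (dash-unique σ d (subst (λ w → Dash σ w z) (bar-involutive x) d′)))))

      edge-closed : ∀ {x y} → On c x → SymClosure (Edge n σ) x y → On c y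
      edge-closed x∈ (fwd (inj₁ (i , refl , refl))) =
        subst (_∈ _) (≡-trans (block-plain i) (sym (block-barred i))) x∈
      edge-closed x∈ (bwd (inj₁ (i , refl , refl))) =
        subst (_∈ _) (≡-trans (block-barred i) (sym (block-plain i))) x∈
      edge-closed x∈ (fwd (inj₂ e)) = dash-closed x∈ (dashedEdge⇒dash e)
      edge-closed x∈ (bwd (inj₂ e)) = dash-closed x∈ (dash-sym σ (dashedEdge⇒dash e))

      connected-closed : ∀ {x y} → On c x → Connected n σ x y → On c y
      connected-closed x∈ ε       = x∈
      connected-closed x∈ (e ◅ p) = connected-closed (edge-closed x∈ e) p

      component↭ : ∀ {x} → Unique (map block (proj₁ c ∷ proj₂ c)) → On c x →
        component n σ x ↭ both (proj₁ c ∷ proj₂ c)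
      component↭ {x} u x∈ = unique-set⇒↭ (filter⁺ _ (allFin⁺ (n * 2))) (unique-both _ u)
        (λ y∈ → ∈-both⁺ _ (connected-closed x∈ (proj₂ (∈-filter⁻ (connected? n σ x) {xs = allFin (n * 2)} y∈))))
        (λ {y} y∈ → ∈-filter⁺ (connected? n σ x) (∈-allFin y) (cycle-connected x∈ (∈-both⁻ _ y∈)))

  least : Cycle → Point n
  least (v , vs) = proj₁ (minimum v (bar n v ∷ both vs))

  least-on : ∀ c → On c (least c)
  least-on (v , vs) = ∈-both⁻ (v ∷ vs) (proj₁ (proj₂ (minimum v (bar n v ∷ both vs))))

  least-≤ : ∀ c {x} → On c x → least c Fin.≤ x
  least-≤ (v , vs) x∈ = proj₂ (proj₂ (minimum v (bar n v ∷ both vs))) (∈-both⁺ (v ∷ vs) x∈)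

  on⇒blocks : ∀ {D c x} → c ∈ D → On c x → block x ∈ blocks D
  on⇒blocks (here refl) x∈ = ∈-++⁺ˡ x∈
  on⇒blocks {c₀ ∷ D} (there c∈) x∈ = ∈-++⁺ʳ (map block (proj₁ c₀ ∷ proj₂ c₀)) (on⇒blocks c∈ x∈)

  blocks⇒on : ∀ D {x} → block x ∈ blocks D → ∃ λ c → c ∈ D × On c x
  blocks⇒on ((v , vs) ∷ D) x∈ with ∈-++⁻ (map block (v ∷ vs)) x∈
  ... | inj₁ x∈c = (v , vs) , here refl , x∈c
  ... | inj₂ x∈D with c , c∈ , x∈c ← blocks⇒on D x∈D = c , there c∈ , x∈c

  unique-least : ∀ D → Unique (blocks D) → Unique (map least D)
  unique-least []             _ = []
  unique-least ((v , vs) ∷ D) u =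
    ∉⇒All≢ _ (λ l∈ → case ∈-map⁻ least l∈ of λ { (c , c∈ , e) →
      unique-++-disjoint (map block (v ∷ vs)) u (least-on (v , vs))
        (on⇒blocks c∈ (subst (On c) (sym e) (least-on c))) }) ∷
    unique-least D (unique-++ʳ (map block (v ∷ vs)) u)

  unique-cycle : ∀ {D c} → Unique (blocks D) → c ∈ D → Unique (map block (proj₁ c ∷ proj₂ c))
  unique-cycle {(v , vs) ∷ D} u (here refl) = unique-++ˡ (map block (v ∷ vs)) u
  unique-cycle {(v , vs) ∷ D} u (there c∈)  = unique-cycle (unique-++ʳ (map block (v ∷ vs)) u) c∈

  module _ {σ : Permutation′ (n * 2)} {D : List Cycle} (dec : Decomposition n ≤-refl σ D) where

    private
      u : Unique (blocks D)
      u = unique-blocks ≤-refl {D} (cover dec)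

      Least : Point n → Set
      Least v = ∀ w → Connected n σ v w → v Fin.≤ w

      least? : ∀ v → Dec (Least v)
      least? v = Finₚ.all? λ w → connected? n σ v w →-dec (v Finₚ.≤? w)

    representatives↭ : representatives n σ ↭ map least D
    representatives↭ = unique-set⇒↭ (filter⁺ least? (allFin⁺ (n * 2))) (unique-least D u) to from
      where
      to : ∀ {v} → v ∈ representatives n σ → v ∈ map least D
      to {v} v∈ with blocks⇒on D {v}
        (∈-resp-↭ (↭-sym (cover dec)) (∈-below⁺ n ≤-refl (Finₚ.toℕ<n (block v))))
      ... | c , c∈ , v∈c = subst (_∈ map least D) (sym (Finₚ.≤-antisym
        (proj₂ (∈-filter⁻ least? {xs = allFin (n * 2)} v∈) (least c)
          (cycle-connected σ {c} (All.lookup (cycles dec) c∈) v∈c (least-on c)))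
        (least-≤ c v∈c))) (∈-map⁺ least c∈)
      from : ∀ {v} → v ∈ map least D → v ∈ representatives n σ
      from v∈ with ∈-map⁻ least v∈
      ... | c , c∈ , refl = ∈-filter⁺ least? (∈-allFin (least c)) λ w conn →
        least-≤ c (connected-closed σ {c} (All.lookup (cycles dec) c∈) (least-on c) conn)

    cycleLengths↭ : cycleLengths n σ ↭ map (λ q → 2 * suc q) (sizes D)
    cycleLengths↭ = ↭-trans (map-↭ (length ∘ component n σ) representatives↭)
      (↭-reflexive (lengths D λ c∈ → c∈))
      where
      lengths : ∀ E → (∀ {c} → c ∈ E → c ∈ D) →
        map (length ∘ component n σ) (map least E) ≡ map (λ q → 2 * suc q) (sizes E)
      lengths []      _   = refl
      lengths (c ∷ E) sub = cong₂ _∷_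
        (≡-trans (↭-length (component↭ σ {c} (All.lookup (cycles dec) (sub (here refl)))
                   (unique-cycle u (sub (here refl))) (least-on c)))
                 (length-both (proj₁ c ∷ proj₂ c)))
        (lengths E (sub ∘ there))

  hasCosetType : ∀ (μ : Partition n) {σ D} → Decomposition n ≤-refl σ D →
    sizes D ≡ map (_∸ 1) (parts μ) → HasCosetType n μ σ
  hasCosetType (mkPartition ps _ pos _) {σ} {D} dec eq = ↭-trans (cycleLengths↭ dec)
    (↭-reflexive (≡-trans (cong (map (λ q → 2 * suc q)) eq)
      -- Positivity, which makes `_∸ 1` reversible, is an irrelevant field and is recovered from its
      -- decision procedure.
      (restore ps (recompute (All.all? (_>? 0) ps) pos))))
    where
    restore : ∀ ps → All (_> 0) ps → map (λ q → 2 * suc q) (map (_∸ 1) ps) ≡ map (2 *_) ps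
    restore []           []        = refl
    restore (suc k ∷ ps) (_ ∷ pos) = cong (2 * suc k ∷_) (restore ps pos)

-- The group ring

open import Data.Integer.Base as ℤ using (ℤ; +_; 0ℤ; 1ℤ)
import Data.Integer.Properties as ℤₚ
open import Data.Integer.Tactic.RingSolver using () renaming (solve-∀ to ℤ-solve-∀)

module _ {m : ℕ} where

  private
    Perm : Set
    Perm = Permutation′ m

  -- Permutations with the same values need not be propositionally equal, so functions on them must
  -- be shown to respect `_≈_`.
  Congruent : (Perm → ℤ) → Set
  Congruent f = ∀ {σ τ} → σ ≈ τ → f σ ≡ f τ

  coefficient-cong : ∀ (x : ℤ[S m ]) → Congruent (λ σ → coefficient σ x)
  coefficient-cong []            e = refl
  coefficient-cong ((a , ρ) ∷ x) {σ} {τ} e with σ ≈? ρ | τ ≈? ρ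
  ... | yes _ | yes _ = cong (λ c → a ℤ.+ c) (coefficient-cong x e)
  ... | yes q | no ¬q = contradiction (λ i → ≡-trans (sym (e i)) (q i)) ¬q
  ... | no ¬q | yes q = contradiction (λ i → ≡-trans (e i) (q i)) ¬q
  ... | no _  | no _  = coefficient-cong x e

  coefficient-++ : ∀ (σ : Perm) (x y : ℤ[S m ]) → coefficient σ (x ++ y) ≡ coefficient σ x ℤ.+ coefficient σ y
  coefficient-++ σ []            y = sym (ℤₚ.+-identityˡ _)
  coefficient-++ σ ((a , τ) ∷ x) y with σ ≈? τ
  ... | yes _ = ≡-trans (cong (λ c → a ℤ.+ c) (coefficient-++ σ x y)) (sym (ℤₚ.+-assoc a _ _))
  ... | no  _ = coefficient-++ σ x y

  -- Left multiplication as an operator on coefficient functions: the coefficient of σ in τ y is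
  -- that of τ⁻¹ σ in y. Products of lists thereby become iterated operators, whatever lists
  -- represent the elements.
  act : ℤ[S m ] → (Perm → ℤ) → Perm → ℤ
  act []            f σ = 0ℤ
  act ((a , τ) ∷ x) f σ = a ℤ.* f (σ ∘ₚ flip τ) ℤ.+ act x f σ

  coefficient-translate : ∀ a τ σ (y : ℤ[S m ]) →
    coefficient σ (map (λ (b , ρ) → (a ℤ.* b , ρ ∘ₚ τ)) y) ≡ a ℤ.* coefficient (σ ∘ₚ flip τ) y
  coefficient-translate a τ σ []            = sym (ℤₚ.*-zeroʳ a)
  coefficient-translate a τ σ ((b , ρ) ∷ y) with σ ≈? (ρ ∘ₚ τ) | (σ ∘ₚ flip τ) ≈? ρ
  ... | yes _ | yes _ = ≡-trans (cong (λ c → a ℤ.* b ℤ.+ c) (coefficient-translate a τ σ y))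
                                (sym (ℤₚ.*-distribˡ-+ a b _))
  ... | yes q | no ¬q = contradiction (λ i → ≡-trans (cong (τ ⟨$⟩ˡ_) (q i)) (inverseˡ τ)) ¬q
  ... | no ¬q | yes q = contradiction (λ i → ≡-trans (sym (inverseʳ τ)) (cong (τ ⟨$⟩ʳ_) (q i))) ¬q
  ... | no _  | no _  = coefficient-translate a τ σ y

  coefficient-· : ∀ x y σ → coefficient σ (x · y) ≡ act x (λ ρ → coefficient ρ y) σ
  coefficient-· []            y σ = refl
  coefficient-· ((a , τ) ∷ x) y σ = ≡-trans
    (coefficient-++ σ (map (λ (b , ρ) → (a ℤ.* b , ρ ∘ₚ τ)) y) (x · y))
    (cong₂ ℤ._+_ (coefficient-translate a τ σ y) (coefficient-· x y σ))

  act-cong : ∀ x {f g} σ → (∀ ρ → f ρ ≡ g ρ) → act x f σ ≡ act x g σ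
  act-cong []            σ e = refl
  act-cong ((a , τ) ∷ x) σ e = cong₂ (λ b c → a ℤ.* b ℤ.+ c) (e _) (act-cong x σ e)

  act-++ : ∀ x y f σ → act (x ++ y) f σ ≡ act x f σ ℤ.+ act y f σ
  act-++ []            y f σ = sym (ℤₚ.+-identityˡ _)
  act-++ ((a , τ) ∷ x) y f σ =
    ≡-trans (cong (λ c → a ℤ.* f (σ ∘ₚ flip τ) ℤ.+ c) (act-++ x y f σ))
            (sym (ℤₚ.+-assoc (a ℤ.* f (σ ∘ₚ flip τ)) (act x f σ) (act y f σ)))

  act-+ : ∀ x f g σ → act x (λ ρ → f ρ ℤ.+ g ρ) σ ≡ act x f σ ℤ.+ act x g σ
  act-+ []            f g σ = refl
  act-+ ((a , τ) ∷ x) f g σ =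
    ≡-trans (cong (λ c → a ℤ.* (f ρ ℤ.+ g ρ) ℤ.+ c) (act-+ x f g σ)) (lemma a (f ρ) (g ρ) _ _)
    where
    ρ = σ ∘ₚ flip τ
    lemma : ∀ a b c d e → a ℤ.* (b ℤ.+ c) ℤ.+ (d ℤ.+ e) ≡ (a ℤ.* b ℤ.+ d) ℤ.+ (a ℤ.* c ℤ.+ e)
    lemma = ℤ-solve-∀

  act-0 : ∀ x σ → act x (λ _ → 0ℤ) σ ≡ 0ℤ
  act-0 []            σ = refl
  act-0 ((a , τ) ∷ x) σ = cong₂ ℤ._+_ (ℤₚ.*-zeroʳ a) (act-0 x σ)

  act-translate : ∀ a τ y {f} → Congruent f → ∀ σ →
    act (map (λ (b , ρ) → (a ℤ.* b , ρ ∘ₚ τ)) y) f σ ≡ a ℤ.* act y f (σ ∘ₚ flip τ)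
  act-translate a τ []            f-cong σ = sym (ℤₚ.*-zeroʳ a)
  act-translate a τ ((b , ρ) ∷ y) {f} f-cong σ = ≡-trans
    (cong₂ (λ c d → a ℤ.* b ℤ.* c ℤ.+ d)
      (f-cong {σ ∘ₚ flip (ρ ∘ₚ τ)} {(σ ∘ₚ flip τ) ∘ₚ flip ρ} (λ _ → refl))
      (act-translate a τ y f-cong σ))
    (lemma a b _ _)
    where
    lemma : ∀ a b c d → a ℤ.* b ℤ.* c ℤ.+ a ℤ.* d ≡ a ℤ.* (b ℤ.* c ℤ.+ d)
    lemma = ℤ-solve-∀

  act-· : ∀ x y {f} → Congruent f → ∀ σ → act (x · y) f σ ≡ act x (act y f) σ
  act-· []            y f-cong σ = refl
  act-· ((a , τ) ∷ x) y {f} f-cong σ = ≡-trans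
    (act-++ (map (λ (b , ρ) → (a ℤ.* b , ρ ∘ₚ τ)) y) (x · y) f σ)
    (cong₂ ℤ._+_ (act-translate a τ y f-cong σ) (act-· x y f-cong σ))

  -- A monomial of positive degree either begins with `x`, which is then taken out on the left, or
  -- is a monomial in `xs`.
  act-h : ∀ k x xs {f} → Congruent f → ∀ σ →
    act (h (suc k) (x ∷ xs)) f σ ≡ act x (act (h k (x ∷ xs)) f) σ ℤ.+ act (h (suc k) xs) f σ
  act-h k x xs {f} f-cong σ = ≡-trans
    (≡-trans
      (cong (λ y → act y f σ) (concatMap-++ product (map (x ∷_) (multisets k (x ∷ xs))) (multisets (suc k) xs)))
      (act-++ (concatMap product (map (x ∷_) (multisets k (x ∷ xs)))) _ f σ))
    (cong (λ c → c ℤ.+ act (h (suc k) xs) f σ) (factor (multisets k (x ∷ xs))))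
    where
    factor : ∀ ms → act (concatMap product (map (x ∷_) ms)) f σ ≡ act x (act (concatMap product ms) f) σ
    factor []       = sym (act-0 x σ)
    factor (m ∷ ms) = begin
      act (x · product m ++ concatMap product (map (x ∷_) ms)) f σ
        ≡⟨ act-++ (x · product m) _ f σ ⟩
      act (x · product m) f σ ℤ.+ act (concatMap product (map (x ∷_) ms)) f σ
        ≡⟨ cong₂ ℤ._+_ (act-· x (product m) f-cong σ) (factor ms) ⟩
      act x (act (product m) f) σ ℤ.+ act x (act (concatMap product ms) f) σ
        ≡⟨ sym (act-+ x (act (product m) f) (act (concatMap product ms) f) σ) ⟩
      act x (λ ρ → act (product m) f ρ ℤ.+ act (concatMap product ms) f ρ) σ
        ≡⟨ act-cong x σ (λ ρ → sym (act-++ (product m) (concatMap product ms) f ρ)) ⟩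
      act x (act (product m ++ concatMap product ms) f) σ ∎
      where open ≡-Reasoning

  coefficient-filter : ∀ {P : Perm → Set} (P? : ∀ σ → Dec (P σ)) → (∀ {σ τ} → σ ≈ τ → P σ → P τ) →
    ∀ σ xs → coefficient σ (Σ-of (filter P? xs)) ≡
             (if does (P? σ) then coefficient σ (Σ-of xs) else 0ℤ)
  coefficient-filter P? resp σ [] with P? σ
  ... | yes _ = refl
  ... | no  _ = refl
  coefficient-filter P? resp σ (τ ∷ xs) with P? τ
  ... | yes Pτ with σ ≈? τ
  ...   | no _ = coefficient-filter P? resp σ xs
  ...   | yes σ≈τ rewrite coefficient-filter P? resp σ xs
                        | dec-true (P? σ) (resp (λ i → sym (σ≈τ i)) Pτ) = refl
  coefficient-filter P? resp σ (τ ∷ xs) | no ¬Pτ with σ ≈? τ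
  ...   | no _ = coefficient-filter P? resp σ xs
  ...   | yes σ≈τ rewrite coefficient-filter P? resp σ xs
                        | dec-false (P? σ) (¬Pτ ∘ resp σ≈τ) = refl

  coefficient-• : ∀ a (σ : Perm) (x : ℤ[S m ]) → coefficient σ (a • x) ≡ a ℤ.* coefficient σ x
  coefficient-• a σ []            = sym (ℤₚ.*-zeroʳ a)
  coefficient-• a σ ((b , τ) ∷ x) with σ ≈? τ
  ... | yes _ = ≡-trans (cong (λ c → a ℤ.* b ℤ.+ c) (coefficient-• a σ x)) (sym (ℤₚ.*-distribˡ-+ a b _))
  ... | no  _ = coefficient-• a σ x

module _ {m : ℕ} (σ : Permutation′ (suc m)) where

  private
    inserts : List (Fin (suc m)) → List (Permutation′ m) → List (Permutation′ (suc m))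
    inserts = cartesianProductWith (insert Fin.zero)

  ≈insert⁻ : ∀ {j π} → σ ≈ insert Fin.zero j π → σ ⟨$⟩ʳ Fin.zero ≡ j × remove Fin.zero σ ≈ π
  ≈insert⁻ {j} {π} e with refl ← e Fin.zero = refl , λ i → Finₚ.punchIn-injective j _ _
    (≡-trans (sym (punchIn-permute σ Fin.zero i))
      (≡-trans (e (Fin.suc i)) (insert-punchIn Fin.zero j π i)))

  ≈insert⁺ : ∀ {j π} → σ ⟨$⟩ʳ Fin.zero ≡ j → remove Fin.zero σ ≈ π → σ ≈ insert Fin.zero j π
  ≈insert⁺ refl e Fin.zero    = refl
  ≈insert⁺ {j} {π} refl e (Fin.suc i) = ≡-trans (punchIn-permute σ Fin.zero i)
    (≡-trans (cong (Fin.punchIn j) (e i)) (sym (insert-punchIn Fin.zero j π i)))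

  coefficient-insert : ∀ πs → coefficient σ (Σ-of (map (insert Fin.zero (σ ⟨$⟩ʳ Fin.zero)) πs)) ≡
    coefficient (remove Fin.zero σ) (Σ-of πs)
  coefficient-insert []       = refl
  coefficient-insert (π ∷ πs)
    with σ ≈? insert Fin.zero (σ ⟨$⟩ʳ Fin.zero) π | remove Fin.zero σ ≈? π
  ... | yes _ | yes _ = cong (λ c → 1ℤ ℤ.+ c) (coefficient-insert πs)
  ... | yes q | no ¬q = contradiction (proj₂ (≈insert⁻ q)) ¬q
  ... | no ¬q | yes q = contradiction (≈insert⁺ refl q) ¬q
  ... | no _  | no _  = coefficient-insert πs

  coefficient-insert-≢ : ∀ {j} → σ ⟨$⟩ʳ Fin.zero ≢ j → ∀ πs →
    coefficient σ (Σ-of (map (insert Fin.zero j) πs)) ≡ 0ℤ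
  coefficient-insert-≢     ≢j []       = refl
  coefficient-insert-≢ {j} ≢j (π ∷ πs) with σ ≈? insert Fin.zero j π
  ... | yes q = contradiction (proj₁ (≈insert⁻ q)) ≢j
  ... | no  _ = coefficient-insert-≢ ≢j πs

  coefficient-inserts-step : ∀ j js πs → coefficient σ (Σ-of (inserts (j ∷ js) πs)) ≡
    coefficient σ (Σ-of (map (insert Fin.zero j) πs)) ℤ.+ coefficient σ (Σ-of (inserts js πs))
  coefficient-inserts-step j js πs =
    ≡-trans (cong (coefficient σ) (map-++ (1ℤ ,_) (map (insert Fin.zero j) πs) (inserts js πs)))
            (coefficient-++ σ (Σ-of (map (insert Fin.zero j) πs)) _)

  coefficient-inserts-∉ : ∀ js πs → σ ⟨$⟩ʳ Fin.zero ∉ js → coefficient σ (Σ-of (inserts js πs)) ≡ 0ℤ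
  coefficient-inserts-∉ []       πs ∉js = refl
  coefficient-inserts-∉ (j ∷ js) πs ∉js = ≡-trans (coefficient-inserts-step j js πs)
    (cong₂ ℤ._+_ (coefficient-insert-≢ (∉js ∘ here) πs) (coefficient-inserts-∉ js πs (∉js ∘ there)))

  coefficient-inserts : ∀ {js} πs → Unique js → σ ⟨$⟩ʳ Fin.zero ∈ js →
    coefficient σ (Σ-of (inserts js πs)) ≡ coefficient (remove Fin.zero σ) (Σ-of πs)
  coefficient-inserts {j ∷ js} πs u (here refl) = ≡-trans (coefficient-inserts-step j js πs)
    (≡-trans (cong₂ ℤ._+_ (coefficient-insert πs) (coefficient-inserts-∉ js πs (Unique[x∷xs]⇒x∉xs u)))
             (ℤₚ.+-identityʳ _))
  coefficient-inserts {j ∷ js} πs u@(_ ∷ u′) (there ∈js) = ≡-trans (coefficient-inserts-step j js πs)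
    (≡-trans (cong₂ ℤ._+_
               (coefficient-insert-≢ (λ { refl → Unique[x∷xs]⇒x∉xs u ∈js }) πs)
               (coefficient-inserts πs u′ ∈js))
             (ℤₚ.+-identityˡ _))

-- Up to `_≈_`, a permutation is determined by the image of 0 and by what `remove` leaves of it, so
-- exactly one choice in each round of insertions produces it.
coefficient-permutations : ∀ m (σ : Permutation′ m) → coefficient σ (Σ-of (permutations m)) ≡ 1ℤ
coefficient-permutations zero    σ with σ ≈? idₚ
... | yes _ = refl
... | no ¬q = contradiction (λ ()) ¬q
coefficient-permutations (suc m) σ =
  ≡-trans (coefficient-inserts σ (permutations m) (allFin⁺ (suc m)) (∈-allFin _))
          (coefficient-permutations m (remove Fin.zero σ))

coefficient-class : ∀ {m} {P : Permutation′ m → Set} (P? : ∀ σ → Dec (P σ)) →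
  (∀ {σ τ} → σ ≈ τ → P σ → P τ) → ∀ σ →
  coefficient σ (Σ-of (filter P? (permutations m))) ≡ + (if does (P? σ) then 1 else 0)
coefficient-class {m} P? resp σ
  rewrite coefficient-filter P? resp σ (permutations m) | coefficient-permutations m σ with does (P? σ)
... | true  = refl
... | false = refl

-- The coefficients of `hJ n k · p n` as the numbers `F`

module JucysMurphy (n : ℕ) where
  open Points n
  open Matchings n

  hyperoctahedral-cong : ∀ {σ τ} → σ ≈ τ → Hyperoctahedral n σ → Hyperoctahedral n τ
  hyperoctahedral-cong e hyp v =
    ≡-trans (cong (bar n) (sym (e v))) (≡-trans (hyp v) (e (bar n v)))

  act-J : ∀ i (f : Permutation′ (n * 2) → ℤ) (g : Permutation′ (n * 2) → ℕ) σ → (∀ ρ → f ρ ≡ + g ρ) →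
    act (J n i) f σ ≡ + sum (map (λ s → g (swapped σ s (plain n i))) (earlier i))
  act-J i f g σ e = go (earlier i)
    where
    go : ∀ ss → act (Σ-of (map (λ s → transpose s (plain n i)) ss)) f σ ≡
      + sum (map (λ s → g (swapped σ s (plain n i))) ss)
    go []       = refl
    go (s ∷ ss) = ≡-trans
      (cong₂ ℤ._+_ (≡-trans (ℤₚ.*-identityˡ _) (e (swapped σ s (plain n i)))) (go ss))
      (sym (ℤₚ.pos-+ (g (swapped σ s (plain n i))) _))

  act-hJ : ∀ k L σ → act (h k (map (J n) L)) (λ ρ → coefficient ρ (p n)) σ ≡ + F k L σ
  act-hJ zero L σ = ≡-trans (ℤₚ.+-identityʳ _) (≡-trans (ℤₚ.*-identityˡ _)
    (≡-trans (coefficient-cong (p n) {σ ∘ₚ flip idₚ} {σ} (λ _ → refl))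
      (coefficient-class (hyperoctahedral? n) (λ {σ} {τ} → hyperoctahedral-cong {σ} {τ}) σ)))
  act-hJ (suc k) []      σ = refl
  act-hJ (suc k) (i ∷ L) σ = ≡-trans
    (act-h k (J n i) (map (J n) L) (coefficient-cong (p n)) σ)
    (≡-trans
      (cong₂ ℤ._+_ (act-J i _ (F k (i ∷ L)) σ (act-hJ k (i ∷ L))) (act-hJ (suc k) L σ))
      (sym (ℤₚ.pos-+ (sum (map (λ s → F k (i ∷ L) (swapped σ s (plain n i))) (earlier i))) _)))

  reverse-take-tabulate : ∀ {A : Set} (f : Fin n → A) m .(m≤n : m ≤ n) →
    reverse (take m (tabulate f)) ≡ map f (below m m≤n)
  reverse-take-tabulate f zero    _   = refl
  reverse-take-tabulate f (suc m) m<n = begin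
    reverse (take (suc m) (tabulate f))
      ≡⟨ cong (λ j → reverse (take (suc j) (tabulate f))) (sym (Finₚ.toℕ-fromℕ< m<n)) ⟩
    reverse (take (suc (toℕ i)) (tabulate f))
      ≡⟨ cong reverse (take-suc-tabulate f i) ⟩
    reverse (take (toℕ i) (tabulate f) ++ f i ∷ [])
      ≡⟨ reverse-++ (take (toℕ i) (tabulate f)) (f i ∷ []) ⟩
    f i ∷ reverse (take (toℕ i) (tabulate f))
      ≡⟨ cong (λ j → f i ∷ reverse (take j (tabulate f))) (Finₚ.toℕ-fromℕ< m<n) ⟩
    f i ∷ reverse (take m (tabulate f))
      ≡⟨ cong (f i ∷_) (reverse-take-tabulate f m (<⇒≤ m<n)) ⟩
    f i ∷ map f (below m (<⇒≤ m<n)) ∎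
    where
    open ≡-Reasoning
    i = fromℕ< m<n

  reverse-tabulate : ∀ {A : Set} (f : Fin n → A) → reverse (tabulate f) ≡ map f (below n ≤-refl)
  reverse-tabulate f = ≡-trans
    (cong reverse (sym (take-all n (tabulate f) (≤-reflexive (length-tabulate f)))))
    (reverse-take-tabulate f n ≤-refl)

  coefficient-hJ·p : ∀ k σ → coefficient σ (hJ n k · p n) ≡ + F k (below n ≤-refl) σ
  coefficient-hJ·p k σ = ≡-trans (coefficient-· (hJ n k) (p n) σ)
    (≡-trans (cong (λ xs → act (h k xs) (λ ρ → coefficient ρ (p n)) σ) (reverse-tabulate (J n)))
             (act-hJ k (below n ≤-refl) σ))

-- Partitions

module _ {A B : Set} (f : A → List B) (back : B → A) where

  -- Since `back` recovers the origin `x` of each member of `f x`, the lists of different origins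
  -- are disjoint.
  unique-concatMap : ∀ xs → (∀ {x y} → x ∈ xs → y ∈ f x → back y ≡ x) →
    (∀ x → Unique (f x)) → Unique xs → Unique (concatMap f xs)
  unique-concatMap []       _     _  _ = []
  unique-concatMap (x ∷ xs) back≡ uf u@(_ ∷ u′) =
    Uniqueₚ.++⁺ (uf x)
      (unique-concatMap xs (back≡ ∘ there) uf u′)
      λ { {y} (y∈ , y∈′) → case Mem.find (∈-concatMap⁻ f {xs = xs} y∈′) of λ { (x′ , x′∈ , y∈x′) →
        Unique[x∷xs]⇒x∉xs u (subst (_∈ xs)
          (≡-trans (sym (back≡ (there x′∈) y∈x′)) (back≡ (here refl) y∈)) x′∈) } }

∈-compositions⁻ : ∀ n {ps} → ps ∈ compositions n → All (_> 0) ps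
∈-compositions⁻ zero    (here refl) = []
∈-compositions⁻ (suc n) ps∈ with Mem.find (∈-concatMap⁻ _ {xs = compositions n} ps∈)
... | []     , _   , here refl         = s≤s z≤n ∷ []
... | q ∷ qs , qs∈ , here refl         = s≤s z≤n ∷ ∈-compositions⁻ n qs∈
... | q ∷ qs , qs∈ , there (here refl) = s≤s z≤n ∷ All.tail (∈-compositions⁻ n qs∈)

∈-compositions⁺ : ∀ n {ps} → All (_> 0) ps → sum ps ≡ n → ps ∈ compositions n
∈-compositions⁺ zero    {[]}         _          _ = here refl
∈-compositions⁺ zero    {zero ∷ ps}  (() ∷ _)   _
∈-compositions⁺ zero    {suc q ∷ ps} _          ()
∈-compositions⁺ (suc n) {1 ∷ []}           _ e =
  ∈-concatMap⁺ _ (lose (∈-compositions⁺ n [] (suc-injective e)) (here refl))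
∈-compositions⁺ (suc n) {1 ∷ q ∷ ps}       (_ ∷ pos) e =
  ∈-concatMap⁺ _ (lose (∈-compositions⁺ n pos (suc-injective e)) (here refl))
∈-compositions⁺ (suc n) {suc (suc p) ∷ ps} (_ ∷ pos) e =
  ∈-concatMap⁺ _ (lose (∈-compositions⁺ n {suc p ∷ ps} (s≤s z≤n ∷ pos) (suc-injective e)) (there (here refl)))

unique-compositions : ∀ n → Unique (compositions n)
unique-compositions zero    = [] ∷ []
unique-compositions (suc n) = unique-concatMap _ shorten (compositions n)
  (λ { {[]}          _  (here refl)         → refl
     ; {_ ∷ _}       _  (here refl)         → refl
     -- If a part 0 could occur, `1 ∷ ps` would come from both `ps` and `zero ∷ ps`.
     ; {zero ∷ _}    x∈ (there (here refl)) → case All.head (∈-compositions⁻ n x∈) of λ ()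
     ; {suc _ ∷ _}   _  (there (here refl)) → refl })
  (λ { [] → [] ∷ [] ; (q ∷ qs) → ((λ ()) ∷ []) ∷ [] ∷ [] })
  (unique-compositions n)
  where
  shorten : List ℕ → List ℕ
  shorten (1 ∷ ps)           = ps
  shorten (suc (suc q) ∷ ps) = suc q ∷ ps
  shorten _                  = []

decreasing-unique : ∀ {ps qs} → Linked _≥_ ps → Linked _≥_ qs → ps ↭ qs → ps ≡ qs
decreasing-unique d e perm =
  Pointwise-≡⇒≡ (↗↭↗⇒≋ (Flip.totalOrder ≤-totalOrder) d e (↭⇒↭ₛ perm))

module _ {n : ℕ} where

  valid? : ∀ ps → Dec (Linked _≥_ ps × All (_> 0) ps × sum ps ≡ n)
  valid? ps = linked? _≥?_ ps ×-dec All.all? (_>? 0) ps ×-dec (sum ps ≟ n)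

  asPartition-parts : ∀ ps {μ} → asPartition n ps ≡ just μ → parts μ ≡ ps
  asPartition-parts ps e with valid? ps
  asPartition-parts ps refl | yes _ = refl

  asPartition-complete : ∀ (μ : Partition n) → asPartition n (parts μ) ≡ just μ
  asPartition-complete (mkPartition ps d pos s) with valid? ps
  ... | yes _ = refl
  ... | no ¬v = contradiction
    (recompute (linked? _≥?_ ps) d , recompute (All.all? (_>? 0) ps) pos ,
     recompute (sum ps ≟ n) s) ¬v

  parts∈compositions : ∀ (μ : Partition n) → parts μ ∈ compositions n
  parts∈compositions (mkPartition ps _ pos s) = ∈-compositions⁺ n
    (recompute (All.all? (_>? 0) ps) pos) (recompute (sum ps ≟ n) s)

  -- Doubling is injective, and a multiset has only one decreasing arrangement.
  cosetType-unique : ∀ {μ ν : Partition n} {σ} → HasCosetType n μ σ → HasCosetType n ν σ → parts μ ≡ parts ν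
  cosetType-unique {mkPartition ps d _ _} {mkPartition qs e _ _} t t′
    with ↭-map-inv (2 *_) (↭-trans (↭-sym t) t′)
  ... | qs′ , eq , perm with refl ← map-injective (λ {x} {y} → *-cancelˡ-≡ x y 2) eq =
    decreasing-unique (recompute (linked? _≥?_ ps) d) (recompute (linked? _≥?_ qs) e) perm

  module _ {σ τ : Permutation′ (n * 2)} (σ≈τ : σ ≈ τ) where

    edge-cong : ∀ {v w} → Edge n σ v w → Edge n τ v w
    edge-cong (inj₁ e)             = inj₁ e
    edge-cong (inj₂ (i , e , e′)) = inj₂ (i , ≡-trans e (σ≈τ _) , ≡-trans e′ (σ≈τ _))

    connected-cong : ∀ {v w} → Connected n σ v w → Connected n τ v w
    connected-cong = EqClosure.map edge-cong

  cycleLengths-cong : ∀ {σ τ} → σ ≈ τ → cycleLengths n σ ≡ cycleLengths n τ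
  cycleLengths-cong {σ} {τ} σ≈τ = ≡-trans
    (map-cong (λ v → cong length (filter-≐ (connected? n σ v) (connected? n τ v)
                (to , from) (allFin (n * 2)))) (representatives n σ))
    (cong (map _) (filter-≐ _ _
      ((λ l w c → l w (from c)) , (λ l w c → l w (to c))) (allFin (n * 2))))
    where
    to : ∀ {v w} → Connected n σ v w → Connected n τ v w
    to = connected-cong {σ} {τ} σ≈τ
    from : ∀ {v w} → Connected n τ v w → Connected n σ v w
    from = connected-cong {τ} {σ} (λ i → sym (σ≈τ i))

  hasCosetType-cong : ∀ (μ : Partition n) {σ τ} → σ ≈ τ → HasCosetType n μ σ → HasCosetType n μ τ
  hasCosetType-cong μ {σ} {τ} σ≈τ t = subst (_↭ map (2 *_) (parts μ)) (cycleLengths-cong {σ} {τ} σ≈τ) t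

  coefficient-𝒞 : ∀ (μ : Partition n) σ →
    coefficient σ (𝒞 n μ) ≡ + (if does (hasCosetType? n μ σ) then 1 else 0)
  coefficient-𝒞 μ σ = coefficient-class (hasCosetType? n μ) (λ {σ} {τ} → hasCosetType-cong μ {σ} {τ}) σ

  module _ (b : Partition n → ℤ) (μ : Partition n) (σ : Permutation′ (n * 2)) (type : HasCosetType n μ σ) where

    private
      term : Partition n → ℤ[S n * 2 ]
      term ν = b ν • 𝒞 n ν

    coefficient-term : coefficient σ (term μ) ≡ b μ
    coefficient-term = ≡-trans (coefficient-• (b μ) σ (𝒞 n μ))
      (≡-trans (cong (λ c → b μ ℤ.* c) (≡-trans (coefficient-𝒞 μ σ)
        (cong (λ t → + (if t then 1 else 0)) (dec-true (hasCosetType? n μ σ) type))))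
        (ℤₚ.*-identityʳ (b μ)))

    coefficient-other : ∀ ν → parts ν ≢ parts μ → coefficient σ (term ν) ≡ 0ℤ
    coefficient-other ν ν≢μ = ≡-trans (coefficient-• (b ν) σ (𝒞 n ν))
      (≡-trans (cong (λ c → b ν ℤ.* c) (≡-trans (coefficient-𝒞 ν σ)
        (cong (λ t → + (if t then 1 else 0))
          (dec-false (hasCosetType? n ν σ) λ t → ν≢μ (cosetType-unique {ν} {μ} {σ} t type)))))
        (ℤₚ.*-zeroʳ (b ν)))

    private
      rhs : List (List ℕ) → ℤ[S n * 2 ]
      rhs pss = Σ-over (mapMaybe (asPartition n) pss) term

    coefficient-absent : ∀ pss → parts μ ∉ pss → coefficient σ (rhs pss) ≡ 0ℤ
    coefficient-absent []         _  = refl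
    coefficient-absent (ps ∷ pss) ∉ with asPartition n ps in eq
    ... | nothing = coefficient-absent pss (∉ ∘ there)
    ... | just ν  = ≡-trans (coefficient-++ σ (term ν) _) (cong₂ ℤ._+_
      (coefficient-other ν (λ e → ∉ (here (≡-trans (sym e) (asPartition-parts ps eq)))))
      (coefficient-absent pss (∉ ∘ there)))

    coefficient-present : ∀ pss → Unique pss → parts μ ∈ pss → coefficient σ (rhs pss) ≡ b μ
    coefficient-present (_ ∷ pss) u (here refl) rewrite asPartition-complete μ =
      ≡-trans (coefficient-++ σ (term μ) _)
        (≡-trans (cong₂ ℤ._+_ coefficient-term (coefficient-absent pss (Unique[x∷xs]⇒x∉xs u)))
                 (ℤₚ.+-identityʳ (b μ)))
    coefficient-present (ps ∷ pss) u@(_ ∷ u′) (there μ∈) with asPartition n ps in eq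
    ... | nothing = coefficient-present pss u′ μ∈
    ... | just ν  = ≡-trans (coefficient-++ σ (term ν) _)
      (≡-trans (cong₂ ℤ._+_
        (coefficient-other ν (λ e → Unique[x∷xs]⇒x∉xs u
          (subst (_∈ pss) (≡-trans (sym e) (asPartition-parts ps eq)) μ∈)))
        (coefficient-present pss u′ μ∈)) (ℤₚ.+-identityˡ (b μ)))

    -- The classes are disjoint and each partition is listed once, so evaluation at one permutation
    -- of type `μ` isolates `b μ`.
    coefficient-partitions : coefficient σ (Σ-over (partitions n) term) ≡ b μ
    coefficient-partitions =
      coefficient-present (compositions n) (unique-compositions n) (parts∈compositions μ)

-- Evaluation at one permutation of type `μ`

sum-pred : ∀ ps → All (_> 0) ps → sum (map (_∸ 1) ps) + length ps ≡ sum ps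
sum-pred []           []        = refl
sum-pred (suc k ∷ ps) (_ ∷ pos) = ≡-trans (lemma k (sum (map (_∸ 1) ps)) (length ps))
  (cong (λ t → suc k + t) (sum-pred ps pos))
  where
  lemma : ∀ k x l → k + x + suc l ≡ suc k + (x + l)
  lemma = solve-∀

theorem3p13 : (n : ℕ) (μ : Partition n) (b : Partition n → ℤ) →
    IsCoefficientFamily n (n ∸ ℓ μ + 1) b →
    b μ ≡ + 𝔄 (map (_∸ 1) (parts μ))
theorem3p13 n μ@(mkPartition ps _ pos s) b family =
  let σ , D , dec , sizes≡ = CosetTypes.realize n n ≤-refl (map (_∸ 1) ps) total
  in proof σ D dec sizes≡
  where
  open ≡-Reasoning
  open Points n
  open Matchings n

  Σμ∸1 : sum (map (_∸ 1) ps) + length ps ≡ n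
  Σμ∸1 = ≡-trans (sum-pred ps (recompute (All.all? (_>? 0) ps) pos)) (recompute (sum ps ≟ n) s)

  total : sum (map (_∸ 1) ps) + length (map (_∸ 1) ps) ≡ n
  total = ≡-trans (cong (λ l → sum (map (_∸ 1) ps) + l) (length-map (_∸ 1) ps)) Σμ∸1

  degree : n ∸ length ps + 1 ≡ suc (sum (map (_∸ 1) ps))
  degree = ≡-trans (+-comm (n ∸ length ps) 1) (cong suc
    (≡-trans (cong (_∸ length ps) (sym Σμ∸1)) (m+n∸n≡m (sum (map (_∸ 1) ps)) (length ps))))

  proof : ∀ σ D → Decomposition n ≤-refl σ D → sizes D ≡ map (_∸ 1) ps →
    b μ ≡ + 𝔄 (map (_∸ 1) ps)
  proof σ D dec sizes≡ = begin
    b μ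
      ≡⟨ sym (coefficient-partitions b μ σ (CosetTypes.hasCosetType n μ dec sizes≡)) ⟩
    coefficient σ (Σ-over (partitions n) (λ ν → b ν • 𝒞 n ν))
      ≡⟨ sym (family σ) ⟩
    coefficient σ (hJ n (n ∸ length ps + 1) · p n)
      ≡⟨ JucysMurphy.coefficient-hJ·p n (n ∸ length ps + 1) σ ⟩
    + F (n ∸ length ps + 1) (below n ≤-refl) σ
      -- The comparison takes place between doubled values, because `val` and `doubleAreaSum` are
      -- doubled.
      ≡⟨ cong +_ (*-cancelˡ-≡ _ _ 2 (begin
        2 * F (n ∸ length ps + 1) (below n ≤-refl) σ
          ≡⟨ cong (λ k → 2 * F k (below n ≤-refl) σ)
               (≡-trans degree (cong (suc ∘ sum) (sym sizes≡))) ⟩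
        2 * F (suc (sum (sizes D))) (below n ≤-refl) σ
          ≡⟨ F-val (suc (sum (sizes D))) n ≤-refl σ D dec (≤-reflexive excess) ⟩
        val (suc (suc (sum (sizes D))) ∸ sum (sizes D)) (sizes D)
          ≡⟨ cong₂ val excess sizes≡ ⟩
        doubleAreaSum (map (_∸ 1) ps)
          ≡⟨ sym (2*𝔄 (map (_∸ 1) ps)) ⟩
        2 * 𝔄 (map (_∸ 1) ps) ∎)) ⟩
    + 𝔄 (map (_∸ 1) ps) ∎
    where
    -- The degree is one above the threshold `sum (sizes D)`. The difference is thus 2, the largest
    -- that `F-val` admits and the one at which `val` is the double area.
    excess : suc (suc (sum (sizes D))) ∸ sum (sizes D) ≡ 2
    excess = m+n∸n≡m 2 (sum (sizes D))
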